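{- Let $n$ and $k$ be integers with $3\le k<n$. The average number of cycles of length $k$ in a triangulated $n$-gon (the average being over all triangulations of the $n$-gon) is $$\binom{2n-k-1}{n-1}\frac{C_{k-2}}{C_{n-2}}.$$
   Context: $C_m=\frac{1}{m+1}\binom{2m}{m}$ for $m\ge 0$ denotes the $m$-th Catalan number. Fix a convex $n$-gon with labelled (distinguishable) vertices. A triangulation of the $n$-gon is a partition of it into $n-2$ triangles by $n-3$ pairwise noncrossing diagonals; triangulations are distinct when their sets of diagonals differ (no identification under rotation or reflection). A triangulation is regarded as a simple graph on the $n$ vertices of the polygon whose edges are the $n$ sides of the polygon and the $n-3$ diagonals. A cycle of length $k$ is a cycle subgraph with $k$ vertices (unrooted and unoriented). The average is the uniform average over all triangulations of the $n$-gon. -}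

module Defs where

open import Data.Fin.Base using (Fin; toℕ; _<_)
open import Data.Fin.Properties using (all?; any?; _<?_; _≟_)
open import Data.Fin.Subset using (Subset; inside; outside; ∣_∣; _∈_; _∪_)
open import Data.Fin.Subset.Properties using (_∈?_)
open import Data.Integer.Base using (+_)
open import Data.List.Base
  using (List; []; _∷_; length; map; filter; cartesianProductWith)
open import Data.Nat.Base as ℕ using (ℕ; zero; suc; _*_; _∸_; >-nonZero)
open import Data.Nat.ListAction using (sum)
import Data.Nat.Properties as ℕ
open import Data.Nat.Properties using (_!≢0; _!*_!≢0)
open import Data.Nat.Combinatorics using (_C_; nCk≡n!/k![n-k]!; k![n∸k]!∣n!)
open import Data.Nat.Divisibility using (∣⇒≤)
open import Data.Nat.DivMod using (m≥n⇒m/n>0)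
open import Data.Product.Base using (∃; ∃-syntax; _×_; _,_)
open import Data.Product.Properties using (≡-dec)
open import Data.Rational.Base as ℚ using (ℚ; 0ℚ)
import Data.Rational.Properties as ℚ
open import Data.Sum.Base using (_⊎_)
open import Data.Vec.Base as Vec using (Vec; []; _∷_; _∷ʳ_; zip; zipWith; tabulate; lookup)
import Data.Vec.Properties as Vec
import Data.Vec.Membership.DecPropositional as VecDecMembership
import Data.Vec.Membership.Propositional as VecMembership
open import Data.Vec.Relation.Unary.AllPairs using (allPairs?)
open import Data.Vec.Relation.Unary.Unique.Propositional using (Unique)
open import Data.Bool.Properties using () renaming (_≟_ to _≟ᵇ_)
open import Level using (Level)
open import Relation.Binary.PropositionalEquality using (_≡_; sym; subst)
open import Relation.Nullary.Decidable
  using (Dec; does; map′; ¬?; _×-dec_; _⊎-dec_; _→-dec_)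
open import Relation.Nullary.Negation using (¬_)
open import Relation.Unary using (Pred; Decidable)

private
  variable
    p   : Level
    k n : ℕ

-- An edge {i , j} of a simple graph on Fin n is stored as the ordered
-- pair (i , j) with i < j.  The type itself does not enforce i < j.

EdgeSet : ℕ → Set
EdgeSet n = Vec (Subset n) n

_∋⟨_,_⟩ : EdgeSet n → Fin n → Fin n → Set
F ∋⟨ i , j ⟩ = j ∈ lookup F i

_∋?⟨_,_⟩ : (F : EdgeSet n) (i j : Fin n) → Dec (F ∋⟨ i , j ⟩)
F ∋?⟨ i , j ⟩ = j ∈? lookup F i

∥_∥ : EdgeSet n → ℕ
∥ F ∥ = Vec.sum (Vec.map ∣_∣ F)

_⊑_ : EdgeSet n → EdgeSet n → Set
F ⊑ G = ∀ i j → F ∋⟨ i , j ⟩ → G ∋⟨ i , j ⟩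

_⊑?_ : (F G : EdgeSet n) → Dec (F ⊑ G)
F ⊑? G = all? λ i → all? λ j → (F ∋?⟨ i , j ⟩) →-dec (G ∋?⟨ i , j ⟩)

_⊔_ : EdgeSet n → EdgeSet n → EdgeSet n
_⊔_ = zipWith _∪_

⟪_⟫ : {P : Fin n → Fin n → Set p} → (∀ i j → Dec (P i j)) → EdgeSet n
⟪ P? ⟫ = tabulate λ i → tabulate λ j → does (P? i j)

-- The vertices 0, 1, …, n - 1 are numbered along the boundary.

Side : Fin n → Fin n → Set
Side {n} i j = suc (toℕ i) ≡ toℕ j ⊎ (toℕ i ≡ 0 × suc (toℕ j) ≡ n)

side? : (i j : Fin n) → Dec (Side i j)
side? {n} i j = (suc (toℕ i) ℕ.≟ toℕ j) ⊎-dec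
                ((toℕ i ℕ.≟ 0) ×-dec (suc (toℕ j) ℕ.≟ n))

Diagonal : Fin n → Fin n → Set
Diagonal i j = i < j × ¬ Side i j

diagonal? : (i j : Fin n) → Dec (Diagonal i j)
diagonal? i j = (i <? j) ×-dec ¬? (side? i j)

-- For a < b and c < d, the chords ab and cd meet in an interior point of
-- the polygon, as distinct chords, exactly when Cross a b c d or
-- Cross c d a b.

Cross : (a b c d : Fin n) → Set
Cross a b c d = a < c × c < b × b < d

cross? : (a b c d : Fin n) → Dec (Cross a b c d)
cross? a b c d = (a <? c) ×-dec (c <? b) ×-dec (b <? d)

NonCrossing : EdgeSet n → Set
NonCrossing D = ∀ a b c d → D ∋⟨ a , b ⟩ → D ∋⟨ c , d ⟩ → ¬ Cross a b c d

nonCrossing? : Decidable (NonCrossing {n})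
nonCrossing? D = all? λ a → all? λ b → all? λ c → all? λ d →
  (D ∋?⟨ a , b ⟩) →-dec (D ∋?⟨ c , d ⟩) →-dec ¬? (cross? a b c d)

-- A triangulation is its set of diagonals; n - 3 pairwise noncrossing
-- diagonals always cut the polygon into n - 2 triangles.

IsTriangulation : EdgeSet n → Set
IsTriangulation {n} D =
  ∥ D ∥ ≡ n ∸ 3 ×
  (∀ i j → D ∋⟨ i , j ⟩ → Diagonal i j) ×
  NonCrossing D

isTriangulation? : Decidable (IsTriangulation {n})
isTriangulation? {n} D =
  (∥ D ∥ ℕ.≟ n ∸ 3) ×-dec
  (all? λ i → all? λ j → (D ∋?⟨ i , j ⟩) →-dec diagonal? i j) ×-dec
  nonCrossing? D

sides : ∀ n → EdgeSet n
sides n = ⟪ side? ⟫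

graph : EdgeSet n → EdgeSet n
graph {n} D = D ⊔ sides n

-- The steps v₀v₁, v₁v₂, …, vₖ₋₁v₀ of the closed walk v₀v₁…vₖ₋₁.

steps : {A : Set} → Vec A k → Vec (A × A) k
steps []       = []
steps (v ∷ vs) = zip (v ∷ vs) (vs ∷ʳ v)

Consecutive : Vec (Fin n) k → Fin n → Fin n → Set
Consecutive v i j = i < j × ((i , j) ∈ᵛ steps v ⊎ (j , i) ∈ᵛ steps v)
  where open VecMembership renaming (_∈_ to _∈ᵛ_)

consecutive? : (v : Vec (Fin n) k) (i j : Fin n) → Dec (Consecutive v i j)
consecutive? v i j =
  (i <? j) ×-dec (((i , j) ∈ᵛ? steps v) ⊎-dec ((j , i) ∈ᵛ? steps v))
  where open VecDecMembership (≡-dec _≟_ _≟_) renaming (_∈?_ to _∈ᵛ?_)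

-- A cycle subgraph is represented by its edge set, so that rotating or
-- reversing the traversal v gives the same cycle.  Meant for k ≥ 3.

IsCycle : ∀ k → EdgeSet n → Set
IsCycle {n} k F = ∃[ v ] Unique {n = k} v × F ≡ ⟪ consecutive? v ⟫

anyVec? : {P : Pred (Vec (Fin n) k) p} → Decidable P → Dec (∃ P)
anyVec? {k = zero}  P? = map′ ([] ,_) (λ { ([] , p) → p }) (P? [])
anyVec? {k = suc _} P? = map′
  (λ { (x , xs , p) → x ∷ xs , p })
  (λ { (x ∷ xs , p) → x , xs , p })
  (any? λ x → anyVec? λ xs → P? (x ∷ xs))

isCycle? : ∀ k → Decidable (IsCycle {n} k)
isCycle? k F = anyVec? λ v →
  allPairs? (λ x y → ¬? (x ≟ y)) v ×-dec Vec.≡-dec (Vec.≡-dec _≟ᵇ_) F ⟪ consecutive? v ⟫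

allVecs : {A : Set} → List A → ∀ m → List (Vec A m)
allVecs xs zero    = [] ∷ []
allVecs xs (suc m) = cartesianProductWith _∷_ xs (allVecs xs m)

allEdgeSets : ∀ n → List (EdgeSet n)
allEdgeSets n = allVecs (allVecs (outside ∷ inside ∷ []) n) n

triangulations : ∀ n → List (EdgeSet n)
triangulations n = filter isTriangulation? (allEdgeSets n)

cycles : ℕ → EdgeSet n → List (EdgeSet n)
cycles {n} k G =
  filter (λ F → (F ⊑? G) ×-dec isCycle? k F) (allEdgeSets n)

-- The value at [] is a dummy: every n-gon with n ≥ 3 has a triangulation.

mean : List ℕ → ℚ
mean []          = 0ℚ
mean xs@(_ ∷ _) = + sum xs ℚ./ length xs

averageCycles : (n k : ℕ) → ℚ
averageCycles n k =
  mean (map (λ D → length (cycles k (graph D))) (triangulations n))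

catalan : ℕ → ℚ
catalan m = + ((2 * m) C m) ℚ./ suc m

nCk>0 : ∀ {n k} → k ℕ.≤ n → 0 ℕ.< n C k
nCk>0 {n} {k} k≤n = subst (0 ℕ.<_) (sym (nCk≡n!/k![n-k]! k≤n))
  (m≥n⇒m/n>0 (∣⇒≤ (k![n∸k]!∣n! k≤n)))
  where instance
    _ = n !≢0
    _ = k !* n ∸ k !≢0

catalan-positive : ∀ m → ℚ.Positive (catalan m)
catalan-positive m = ℚ.normalize-pos ((2 * m) C m) (suc m)
  where instance _ = >-nonZero (nCk>0 (ℕ.m≤n*m m 2))

catalan-nonZero : ∀ m → ℚ.NonZero (catalan m)
catalan-nonZero m = ℚ.pos⇒nonZero (catalan m) {{catalan-positive m}}

{-# OPTIONS --safe #-}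
-- A triangulation of the n-gon is a binary tree with n - 2 nodes, and each of
-- its k-cycles bounds the union of the triangles of a connected set of k - 2
-- nodes.  Such a set is determined by the path leading to its top node, its
-- shape (a binary tree with k - 2 nodes, C_{k-2} choices) and the k - 1
-- subtrees hanging below it.  A forest of p trees together with a path, with
-- q nodes in all, is counted by (2q + p) C q through Pascal's rule;
-- here p = k - 1 and q = n - k.

module Submission where

open import Defs
open import Data.Bool.Base using (Bool; true; false)
open import Data.Empty using (⊥; ⊥-elim)
open import Data.Fin.Base as Fin using (Fin; toℕ; fromℕ<; fromℕ; inject₁)
import Data.Fin.Properties as Fin
open import Data.Fin.Subset using (Subset; inside; outside; ∣_∣) renaming (_∈_ to _∈ˢ_)
import Data.Fin.Subset.Properties as Subset
open import Data.Integer.Base as ℤ using (+_)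
import Data.Integer.Properties as ℤ
open import Data.List.Base using (List; []; _∷_; _++_; length; map; filter; reverse; allFin)
open import Data.List.Properties
  using (length-++; length-map; map-++; length-tabulate; length-reverse; unfold-reverse; reverse-++;
         reverse-involutive; ++-assoc; ++-identityʳ; ∷-injectiveˡ; ∷-injectiveʳ)
open import Data.List.Membership.Propositional using (_∈_; _∉_)
open import Data.List.Membership.Propositional.Properties
  using (∈-map⁺; ∈-map⁻; ∈-++⁺ˡ; ∈-++⁺ʳ; ∈-++⁻; ∈-filter⁺; ∈-filter⁻; ∈-∃++;
         ∈-cartesianProductWith⁺; ∈-allFin)
open import Data.List.Membership.Propositional.Properties.WithK using (unique∧set⇒bag)
import Data.List.Membership.DecPropositional as DecMembership
open import Data.List.Relation.Unary.Any using (here; there)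
open import Data.List.Relation.Unary.All as All using (All; []; _∷_)
import Data.List.Relation.Unary.All.Properties as All
open import Data.List.Relation.Unary.AllPairs as AllPairs using (AllPairs; []; _∷_)
open import Data.List.Relation.Unary.Unique.Propositional using (Unique)
import Data.List.Relation.Unary.Unique.Propositional.Properties as Uniq
open import Data.List.Relation.Binary.BagAndSetEquality using (∼bag⇒↭)
open import Data.List.Relation.Binary.Permutation.Propositional using (_↭_; ↭-sym; ↭⇒↭ₛ)
open import Data.List.Relation.Binary.Permutation.Propositional.Properties
  using (↭-length; ++-comm; ↭-reverse; All-resp-↭)
import Data.List.Relation.Binary.Permutation.Setoid.Properties as SetoidPerm
open import Data.Nat.Base
  using (ℕ; zero; suc; _+_; _*_; _∸_; _≤_; _<_; z≤n; s≤s)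
open import Data.Nat.Combinatorics
  using (_C_; nCk≡nC[n∸k]; nCn≡1; nC1≡n; nCk+nC[k+1]≡[n+1]C[k+1]; k>n⇒nCk≡0)
open import Data.Nat.ListAction using (sum)
open import Data.Nat.Properties
open import Data.Nat.Tactic.RingSolver using (solve-∀)
open import Data.Product.Base using (∃; ∃₂; _×_; _,_; proj₁; proj₂; map₁; map₂)
open import Data.Product.Properties using (≡-dec)
open import Data.Rational.Base as ℚ using (_/_; _÷_)
import Data.Rational.Properties as ℚ
open import Data.Rational.Unnormalised.Base as ℚᵘ using (mkℚᵘ; *≡*)
import Data.Rational.Unnormalised.Properties as ℚᵘ
open import Data.Sum.Base as Sum using (_⊎_; inj₁; inj₂; [_,_]′)
open import Data.Unit.Base using (⊤; tt)
open import Data.Vec.Base as Vec using (Vec; []; _∷_; _∷ʳ_; zip; lookup; toList)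
import Data.Vec.Properties as Vec
open import Data.Vec.Membership.Propositional using () renaming (_∈_ to _∈ᵛ_)
open import Data.Vec.Membership.Propositional.Properties using (∈-toList⁺; ∈-toList⁻)
import Data.Vec.Relation.Unary.All.Properties as VecAll
import Data.Vec.Relation.Unary.AllPairs as VecAllPairs
import Data.Vec.Relation.Unary.Unique.Propositional as VecUnique
open import Function.Base using (_∘_; id)
open import Function.Bundles using (mk⇔)
open import Relation.Binary.Definitions using (tri<; tri≈; tri>)
open import Relation.Binary.PropositionalEquality
open import Relation.Nullary using (¬_; Dec; yes; no)
open import Relation.Nullary.Decidable using (dec-true; ¬?; _×-dec_; _⊎-dec_)
open import Relation.Unary using (Decidable)

-- The number (2q + p) C q is the coefficient of x^q in C(x)^p / sqrt(1 - 4x), where C(x) is the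
-- Catalan series: a step of the path chooses a side and a tree, so paths have the series 1 / (1 -
-- 2x C(x)) = 1 / sqrt(1 - 4x). The average arises by counting pairs (triangulation, cycle) in two
-- ways; the number of cycles of an individual triangulation is never computed. The main obstacle is
-- that a cycle is given as an arbitrary simple closed walk in the graph. One fact tames it: once
-- the base edge is removed, the apex of the triangle on the base is a cut vertex. Hence a simple
-- path joining the ends of the base is either the base itself or passes through the apex and splits
-- there into two paths of the same kind, and a cycle that avoids the base stays in one half. The
-- first alternative, iterated, finds the subtrees that are cut off; the second finds the path to
-- the top node.

-- Counting by duplicate-free enumerations

-- Only the elements `x` are listed, not proofs of `P x`, so a predicate such as `IsCycle`, with
-- many witnesses for one edge set, still counts that edge set once.
record Count {A : Set} (P : A → Set) (c : ℕ) : Set where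
  field
    list     : List A
    unique   : Unique list
    sound    : ∀ {x} → x ∈ list → P x
    complete : ∀ {x} → P x → x ∈ list
    size     : length list ≡ c

module _ {A : Set} {P : A → Set} where

  count-unique : ∀ {a b} → Count P a → Count P b → a ≡ b
  count-unique p q = trans (sym P.size) (trans (↭-length (∼bag⇒↭ (unique∧set⇒bag P.unique Q.unique
    (mk⇔ (Q.complete ∘ P.sound) (P.complete ∘ Q.sound))))) Q.size)
    where module P = Count p
          module Q = Count q

  count-∅ : (∀ x → ¬ P x) → Count P 0
  count-∅ ¬p = record
    { list = [] ; unique = [] ; sound = λ () ; complete = λ p → ⊥-elim (¬p _ p) ; size = refl }

  count-empty : Count P 0 → ∀ x → ¬ P x
  count-empty c x px with Count.list c | Count.complete c px | Count.size c
  ... | [] | () | _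

  count-singleton : ∀ x → P x → (∀ y → P y → y ≡ x) → Count P 1
  count-singleton x px only = record
    { list = x ∷ [] ; unique = [] ∷ [] ; sound = λ { (here refl) → px }
    ; complete = λ p → here (only _ p) ; size = refl }

  count-⊎ : ∀ {Q : A → Set} {a b} → Count P a → Count Q b → (∀ x → P x → Q x → ⊥) →
            Count (λ x → P x ⊎ Q x) (a + b)
  count-⊎ p q disj = record
    { list     = P.list ++ Q.list
    ; unique   = Uniq.++⁺ P.unique Q.unique λ (x , y) → disj _ (P.sound x) (Q.sound y)
    ; sound    = λ m → [ inj₁ ∘ P.sound , inj₂ ∘ Q.sound ]′ (∈-++⁻ P.list m)
    ; complete = [ ∈-++⁺ˡ ∘ P.complete , ∈-++⁺ʳ P.list ∘ Q.complete ]′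
    ; size     = trans (length-++ P.list) (cong₂ _+_ P.size Q.size) }
    where module P = Count p
          module Q = Count q

  count-filter : ∀ {Q : A → Set} {a} → Decidable Q → Count P a → ∃ (Count (λ x → P x × Q x))
  count-filter Q? p = _ , record
    { list = filter Q? P.list ; unique = Uniq.filter⁺ Q? P.unique
    ; sound = λ m → map₁ P.sound (∈-filter⁻ Q? m)
    ; complete = λ (x , y) → ∈-filter⁺ Q? (P.complete x) y ; size = refl }
    where module P = Count p

map-unique : ∀ {A B : Set} (f : A → B) {xs} →
             (∀ {x y} → x ∈ xs → y ∈ xs → f x ≡ f y → x ≡ y) → Unique xs → Unique (map f xs)
map-unique f inj []       = []
map-unique f inj (x∉ ∷ u) =
  All.tabulate (λ m e → let y , y∈ , eq = ∈-map⁻ f m in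
    All.lookup x∉ y∈ (inj (here refl) (there y∈) (trans e eq)))
  ∷ map-unique f (λ p q → inj (there p) (there q)) u

module _ {A B : Set} {P : A → Set} {Q : B → Set} where

  -- Injectivity is asked for on `P` alone: an encoding such as `diagonals n` separates trees only
  -- among those of the fitting size.
  count-image : ∀ {c} → Count P c → (f : A → B) →
                (∀ {x y} → P x → P y → f x ≡ f y → x ≡ y) →
                (∀ {x} → P x → Q (f x)) → (∀ {y} → Q y → ∃ λ x → P x × y ≡ f x) → Count Q c
  count-image p f inj into onto = record
    { list     = map f P.list
    ; unique   = map-unique f (λ x y → inj (P.sound x) (P.sound y)) P.unique
    ; sound    = λ m → let x , x∈ , eq = ∈-map⁻ f m in subst Q (sym eq) (into (P.sound x∈))
    ; complete = λ q → let x , px , eq = onto q in subst (_∈ _) (sym eq) (∈-map⁺ f (P.complete px))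
    ; size     = trans (length-map f P.list) P.size }
    where module P = Count p

count-resp : ∀ {A : Set} {P Q : A → Set} {c} → (∀ {x} → P x → Q x) → (∀ {x} → Q x → P x) →
             Count P c → Count Q c
count-resp to from c = count-image c id (λ _ _ → id) to (λ q → _ , from q , refl)

count-⊕ : ∀ {A B C : Set} {P : A → Set} {Q : B → Set} {R : C → Set} {a b} →
          Count P a → Count Q b → (f : A → C) (g : B → C) →
          (∀ {x y} → f x ≡ f y → x ≡ y) → (∀ {x y} → g x ≡ g y → x ≡ y) → (∀ x y → f x ≢ g y) →
          (∀ {x} → P x → R (f x)) → (∀ {y} → Q y → R (g y)) →
          (∀ {z} → R z → (∃ λ x → P x × z ≡ f x) ⊎ (∃ λ y → Q y × z ≡ g y)) →
          Count R (a + b)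
count-⊕ p q f g f-inj g-inj disj into-f into-g onto = count-resp
  [ (λ { (_ , px , refl) → into-f px }) , (λ { (_ , qy , refl) → into-g qy }) ]′ onto
  (count-⊎ (count-image p f (λ _ _ → f-inj) (λ px → _ , px , refl) id)
           (count-image q g (λ _ _ → g-inj) (λ qy → _ , qy , refl) id)
           (λ { _ (x , _ , refl) (y , _ , e) → disj x y e }))

-- The part of `Q` outside `P` has size 0 by cancellation, hence is empty. This turns an inclusion
-- between equally large edge sets into an equality.
count-⊆-⊇ : ∀ {A : Set} {P Q : A → Set} {c} → Count P c → Count Q c → Decidable P →
            (∀ {x} → P x → Q x) → ∀ {x} → Q x → P x
count-⊆-⊇ {P = P} p q P? P⊆Q {x} qx with P? x
... | yes px = px
... | no ¬px = ⊥-elim (count-empty (subst (Count _) d≡0 (proj₂ rest)) x (qx , ¬px))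
  where
  rest = count-filter (¬? ∘ P?) q
  d≡0 = sym (+-cancelˡ-≡ _ 0 _ (trans (+-identityʳ _) (count-unique q
    (count-resp [ P⊆Q , proj₁ ]′ (λ {y} qy → split y qy) (count-⊎ p (proj₂ rest) (λ _ px (_ , ¬px) → ¬px px))))))
    where
    split : ∀ y → _ → _
    split y qy with P? y
    ... | yes py = inj₁ py
    ... | no ¬py = inj₂ (qy , ¬py)

-- Reads a sum of list lengths, the form of the numerator of `mean`, as a number of pairs.
count-Σ : ∀ {A B : Set} {P : A → Set} {c} (p : Count P c) (f : A → List B) → (∀ x → Unique (f x)) →
          Count (λ ((x , y) : A × B) → P x × y ∈ f x) (sum (map (length ∘ f) (Count.list p)))
count-Σ {A} {B} p f f! = count-resp (map₁ (Count.sound p)) (map₁ (Count.complete p))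
  (go (Count.list p) (Count.unique p))
  where
  go : ∀ xs → Unique xs →
       Count (λ ((x , y) : A × B) → x ∈ xs × y ∈ f x) (sum (map (length ∘ f) xs))
  go []       []       = count-∅ λ { _ (() , _) }
  go (x ∷ xs) (x∉ ∷ u) = count-resp
    [ (λ { (_ , y∈ , refl) → here refl , y∈ }) , map₁ there ]′
    (λ { (here refl , y∈) → inj₁ (_ , y∈ , refl) ; (there x∈ , y∈) → inj₂ (x∈ , y∈) })
    (count-⊎ (count-image (record { list = f x ; unique = f! x ; sound = id ; complete = id ; size = refl })
                (x ,_) (λ { _ _ refl → refl }) (λ y∈ → _ , y∈ , refl) id)
             (go xs u)
             (λ { _ (_ , _ , refl) (x∈ , _) → All.lookup x∉ x∈ refl }))

-- Binomial coefficients

nC0≡1 : ∀ n → n C 0 ≡ 1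
nC0≡1 n = trans (nCk≡nC[n∸k] {0} {n} z≤n) (nCn≡1 n)

C-symmetric : ∀ i j → (i + j) C i ≡ (i + j) C j
C-symmetric i j = trans (nCk≡nC[n∸k] (m≤m+n i j)) (cong ((i + j) C_) (m+n∸m≡n i j))

C-absorb : ∀ n k → suc k * (suc n C suc k) ≡ suc n * (n C k)
C-absorb n zero = begin
  1 * (suc n C 1)  ≡⟨ *-identityˡ _ ⟩
  suc n C 1        ≡⟨ nC1≡n (suc n) ⟩
  suc n            ≡⟨ *-identityʳ (suc n) ⟨
  suc n * 1        ≡⟨ cong (suc n *_) (nC0≡1 n) ⟨
  suc n * (n C 0)  ∎
  where open ≡-Reasoning
C-absorb zero (suc k) = trans
  (cong (suc (suc k) *_) (k>n⇒nCk≡0 {1} {suc (suc k)} (s≤s (s≤s z≤n))))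
  (trans (*-zeroʳ (suc (suc k))) (sym (cong (1 *_) (k>n⇒nCk≡0 {0} {suc k} (s≤s z≤n)))))
C-absorb (suc n) (suc k) = begin
  suc (suc k) * (suc (suc n) C suc (suc k))
    ≡⟨ cong (suc (suc k) *_) (nCk+nC[k+1]≡[n+1]C[k+1] (suc n) (suc k)) ⟨
  suc (suc k) * (x + y)
    ≡⟨ expand k x y ⟩
  x + (suc k * x + suc (suc k) * y)
    ≡⟨ cong (_+_ x) (cong₂ _+_ (C-absorb n k) (C-absorb n (suc k))) ⟩
  x + (suc n * (n C k) + suc n * (n C suc k))
    ≡⟨ cong (_+_ x) (*-distribˡ-+ (suc n) (n C k) (n C suc k)) ⟨
  x + suc n * (n C k + n C suc k)
    ≡⟨ cong (λ z → x + suc n * z) (nCk+nC[k+1]≡[n+1]C[k+1] n k) ⟩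
  suc (suc n) * x ∎
  where
  open ≡-Reasoning
  x = suc n C suc k
  y = suc n C suc (suc k)
  expand : ∀ k x y → suc (suc k) * (x + y) ≡ x + (suc k * x + suc (suc k) * y)
  expand = solve-∀

-- Binary trees, pruned trees and contexts

data Tree : Set where
  leaf : Tree
  node : (l r : Tree) → Tree

nodes : Tree → ℕ
nodes leaf       = 0
nodes (node l r) = suc (nodes l + nodes r)

-- A connected set of nodes containing the root, together with the
-- subtrees that hang below it.

data Pruned : Set where
  cut    : Tree → Pruned
  branch : (l r : Pruned) → Pruned

forget : Pruned → Tree
forget (cut t)      = t
forget (branch l r) = node (forget l) (forget r)

kept : Pruned → ℕ
kept (cut _)      = 0
kept (branch l r) = suc (kept l + kept r)

lost : Pruned → ℕ
lost (cut t)      = nodes t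
lost (branch l r) = lost l + lost r

nodes-forget : ∀ p → nodes (forget p) ≡ kept p + lost p
nodes-forget (cut t)      = refl
nodes-forget (branch l r) = cong suc (trans (cong₂ _+_ (nodes-forget l) (nodes-forget r))
  (shuffle (kept l) (lost l) (kept r) (lost r)))
  where
  shuffle : ∀ a b c d → a + b + (c + d) ≡ a + c + (b + d)
  shuffle = solve-∀

-- The path from the root to a marked position, outermost step first.
-- false descends into the left child, true into the right one; the tree
-- is the other child.

Context : Set
Context = List (Bool × Tree)

plug : Context → Tree → Tree
plug []                t = t
plug ((false , r) ∷ c) t = node (plug c t) r
plug ((true  , l) ∷ c) t = node l (plug c t)

context-nodes : Context → ℕ
context-nodes []            = 0
context-nodes ((_ , t) ∷ c) = suc (nodes t + context-nodes c)

nodes-plug : ∀ c t → nodes (plug c t) ≡ nodes t + context-nodes c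
nodes-plug []                t = sym (+-identityʳ _)
nodes-plug ((false , r) ∷ c) t = trans (cong (λ z → suc (z + nodes r)) (nodes-plug c t))
  (shuffle (nodes t) (context-nodes c) (nodes r))
  where
  shuffle : ∀ a b c → suc (a + b + c) ≡ a + suc (c + b)
  shuffle = solve-∀
nodes-plug ((true , l) ∷ c) t = trans (cong (λ z → suc (nodes l + z)) (nodes-plug c t))
  (shuffle (nodes t) (context-nodes c) (nodes l))
  where
  shuffle : ∀ a b c → suc (c + (a + b)) ≡ a + suc (c + b)
  shuffle = solve-∀

-- Forests, ballot numbers and Catalan numbers

forest-nodes : ∀ {p} → Vec Tree p → ℕ
forest-nodes []       = 0
forest-nodes (t ∷ ts) = nodes t + forest-nodes ts

-- Counts the forests of p trees with q nodes in all: the first tree is a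
-- leaf, which is dropped, or it is replaced by its two children.

ballot : ℕ → ℕ → ℕ
ballot p       zero    = 1
ballot zero    (suc q) = 0
ballot (suc p) (suc q) = ballot p (suc q) + ballot (suc (suc p)) q

-- The reflection principle, with the subtraction moved to the left.

ballot-reflection : ∀ p q N → N ≡ suc (q + q + p) → ballot p (suc q) + N C q ≡ N C suc q
-- Without trees `N = 2q + 1`, so the lower indices `q` and `q + 1` are complementary and the
-- reflected term cancels everything.
ballot-reflection zero q N eq =
  trans (cong (_C q) e) (trans (C-symmetric q (suc q)) (cong (_C suc q) (sym e)))
  where e = trans eq (trans (cong suc (+-identityʳ (q + q))) (sym (+-suc q q)))
ballot-reflection (suc p) zero N eq rewrite eq = begin
  ballot p 1 + 1 + suc (suc p) C 0      ≡⟨ cong (_+_ (ballot p 1 + 1)) (nC0≡1 (suc (suc p))) ⟩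
  ballot p 1 + 1 + 1                    ≡⟨ cong (λ z → ballot p 1 + z + 1) (nC0≡1 (suc p)) ⟨
  ballot p 1 + suc p C 0 + 1            ≡⟨ cong₂ _+_ (ballot-reflection p 0 (suc p) refl) (sym (nC0≡1 (suc p))) ⟩
  suc p C 1 + suc p C 0                 ≡⟨ +-comm (suc p C 1) _ ⟩
  suc p C 0 + suc p C 1                 ≡⟨ nCk+nC[k+1]≡[n+1]C[k+1] (suc p) 0 ⟩
  suc (suc p) C 1                       ∎
  where open ≡-Reasoning
ballot-reflection (suc p) (suc q) zero ()
ballot-reflection (suc p) (suc q) (suc N) eq = begin
  x + y + suc N C suc q              ≡⟨ cong (_+_ (x + y)) (nCk+nC[k+1]≡[n+1]C[k+1] N q) ⟨
  x + y + (N C q + N C suc q)        ≡⟨ shuffle x y (N C q) (N C suc q) ⟩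
  (y + N C q) + (x + N C suc q)
    -- Both summands of the recursion fit the same upper index `N`: it drops by one whether `p`
    -- loses one, or `q` loses one while `p` gains one.
    ≡⟨ cong₂ _+_ (ballot-reflection (suc (suc p)) q N (trans (suc-injective eq) (e₂ p q)))
                 (ballot-reflection p (suc q) N (trans (suc-injective eq) (e₁ p q))) ⟩
  N C suc q + N C suc (suc q)        ≡⟨ nCk+nC[k+1]≡[n+1]C[k+1] N (suc q) ⟩
  suc N C suc (suc q)                ∎
  where
  open ≡-Reasoning
  x = ballot p (suc (suc q))
  y = ballot (suc (suc p)) (suc q)
  shuffle : ∀ x y a b → x + y + (a + b) ≡ (y + a) + (x + b)
  shuffle = solve-∀
  e₁ : ∀ p q → suc q + suc q + suc p ≡ suc (suc q + suc q + p)
  e₁ = solve-∀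
  e₂ : ∀ p q → suc q + suc q + suc p ≡ suc (q + q + suc (suc p))
  e₂ = solve-∀

-- Identifies `ballot 1` with the Catalan numbers. By reflection the ballot number is a difference
-- `w - z` of neighbouring binomials; since `(q + 1) w = (q + 2) z`, multiplying the difference by
-- `q + 2` leaves `w`.
ballot-catalan : ∀ q → suc q * ballot 1 q ≡ (2 * q) C q
ballot-catalan zero    = refl
ballot-catalan (suc q) = +-cancelʳ-≡ (suc (suc q) * z) _ _ (begin
  suc (suc q) * ballot 1 (suc q) + suc (suc q) * z
    ≡⟨ *-distribˡ-+ (suc (suc q)) (ballot 1 (suc q)) z ⟨
  suc (suc q) * (ballot 1 (suc q) + z)
    ≡⟨ cong (suc (suc q) *_) (ballot-reflection 1 q N (e q)) ⟩
  suc (suc q) * w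
    ≡⟨⟩
  w + suc q * w
    ≡⟨ cong (_+_ w) absorb ⟩
  w + suc (suc q) * z ∎)
  where
  open ≡-Reasoning
  N = 2 * suc q
  z = N C q
  w = N C suc q
  e : ∀ q → 2 * suc q ≡ suc (q + q + 1)
  e = solve-∀
  regroup : ∀ q z → suc (2 * suc q) * z ≡ suc q * z + suc (suc q) * z
  regroup = solve-∀
  absorb : suc q * w ≡ suc (suc q) * z
  absorb = +-cancelˡ-≡ (suc q * z) _ _ (begin
    suc q * z + suc q * w        ≡⟨ *-distribˡ-+ (suc q) z w ⟨
    suc q * (z + w)              ≡⟨ cong (suc q *_) (nCk+nC[k+1]≡[n+1]C[k+1] N q) ⟩
    suc q * (suc N C suc q)      ≡⟨ C-absorb N q ⟩
    suc N * z                    ≡⟨ regroup q z ⟩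
    suc q * z + suc (suc q) * z  ∎)

graft : ∀ {p} → Vec Tree (suc (suc p)) → Vec Tree (suc p)
graft (l ∷ r ∷ ts) = node l r ∷ ts

graft-injective : ∀ {p} {ts us : Vec Tree (suc (suc p))} → graft ts ≡ graft us → ts ≡ us
graft-injective {ts = _ ∷ _ ∷ _} {us = _ ∷ _ ∷ _} refl = refl

forest-nodes-graft : ∀ {p} (ts : Vec Tree (suc (suc p))) →
                     forest-nodes (graft ts) ≡ suc (forest-nodes ts)
forest-nodes-graft (l ∷ r ∷ ts) = cong suc (+-assoc (nodes l) (nodes r) (forest-nodes ts))

count-forests : ∀ p q → Count (λ (ts : Vec Tree p) → forest-nodes ts ≡ q) (ballot p q)
count-forests zero    zero    = count-singleton [] refl λ { [] _ → refl }
count-forests zero    (suc q) = count-∅ λ { [] () }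
count-forests (suc p) zero    = count-image (count-forests p 0) (leaf ∷_) (λ { _ _ refl → refl }) id
  λ { {leaf ∷ ts} e → ts , e , refl }
count-forests (suc p) (suc q) = count-⊕ (count-forests p (suc q)) (count-forests (suc (suc p)) q)
  (leaf ∷_) graft (λ { refl → refl }) graft-injective (λ { _ (_ ∷ _ ∷ _) () })
  id (λ { {ts} refl → forest-nodes-graft ts })
  λ { {leaf ∷ ts} e → inj₁ (ts , e , refl)
    ; {node l r ∷ ts} e → inj₂ (l ∷ r ∷ ts
      , suc-injective (trans (sym (forest-nodes-graft (l ∷ r ∷ ts))) e) , refl) }

-- Forests together with a path

step : ∀ (b : Bool) → Vec Tree 1 × Context → Vec Tree 0 × Context
step b (t ∷ [] , c) = [] , (b , t) ∷ c

step-injective : ∀ {b x y} → step b x ≡ step b y → x ≡ y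
step-injective {x = _ ∷ [] , _} {y = _ ∷ [] , _} refl = refl

total : ∀ {p} → Vec Tree p × Context → ℕ
total (ts , c) = forest-nodes ts + context-nodes c

total-step : ∀ b x → total (step b x) ≡ suc (total x)
total-step b (t ∷ [] , c) = cong (λ z → suc (z + context-nodes c)) (sym (+-identityʳ (nodes t)))

-- Replacing the first tree by its children, and when no tree is left
-- opening the first step of the context, turns the count into Pascal's rule.

count-forests-context : ∀ p q →
  Count (λ (x : Vec Tree p × Context) → total x ≡ q) ((q + q + p) C q)
count-forests-context zero zero = count-singleton ([] , []) refl
  λ { ([] , []) _ → refl ; ([] , _ ∷ _) () }
count-forests-context zero (suc q) = subst (Count _) binomial
  (count-⊕ (count-forests-context 1 q) (count-forests-context 1 q) (step false) (step true)
    step-injective step-injective (λ { (_ ∷ [] , _) (_ ∷ [] , _) () })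
    (λ { {x} refl → total-step false x }) (λ { {x} refl → total-step true x })
    λ { {[] , []} ()
      ; {[] , (false , t) ∷ c} e → inj₁ ((t ∷ [] , c) , back false (t ∷ [] , c) e , refl)
      ; {[] , (true  , t) ∷ c} e → inj₂ ((t ∷ [] , c) , back true  (t ∷ [] , c) e , refl) })
  where
  open ≡-Reasoning
  back : ∀ b x → total (step b x) ≡ suc q → total x ≡ q
  back b x e = suc-injective (trans (sym (total-step b x)) e)
  -- The two directions of the opened step give the same binomial twice; by symmetry one copy can
  -- take the lower index `q + 1`, which makes the sum an instance of Pascal's rule.
  binomial : (q + q + 1) C q + (q + q + 1) C q ≡ (suc q + suc q + 0) C suc q
  binomial = begin
    (q + q + 1) C q + (q + q + 1) C q      ≡⟨ cong (λ N → N C q + N C q) (e₁ q) ⟩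
    (q + suc q) C q + (q + suc q) C q      ≡⟨ cong (_+_ ((q + suc q) C q)) (C-symmetric q (suc q)) ⟩
    (q + suc q) C q + (q + suc q) C suc q  ≡⟨ nCk+nC[k+1]≡[n+1]C[k+1] (q + suc q) q ⟩
    suc (q + suc q) C suc q                ≡⟨ cong (_C suc q) (e₂ q) ⟩
    (suc q + suc q + 0) C suc q            ∎
    where
    e₁ : ∀ q → q + q + 1 ≡ q + suc q
    e₁ = solve-∀
    e₂ : ∀ q → suc (q + suc q) ≡ suc q + suc q + 0
    e₂ = solve-∀
count-forests-context (suc p) zero = subst (Count _) (trans (nC0≡1 p) (sym (nC0≡1 (suc p))))
  (count-image (count-forests-context p 0) (map₁ (leaf ∷_)) (λ { _ _ refl → refl }) id
    λ { {leaf ∷ ts , c} e → (ts , c) , e , refl })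
count-forests-context (suc p) (suc q) = subst (Count _) binomial
  (count-⊕ (count-forests-context p (suc q)) (count-forests-context (suc (suc p)) q)
    (map₁ (leaf ∷_)) (map₁ graft) (λ { refl → refl }) graft₁-injective
    (λ { _ (_ ∷ _ ∷ _ , _) () }) id (λ { {x} refl → graft₁ x })
    λ { {leaf ∷ ts , c} e → inj₁ ((ts , c) , e , refl)
      ; {node l r ∷ ts , c} e → inj₂ ((l ∷ r ∷ ts , c)
        , suc-injective (trans (sym (graft₁ (l ∷ r ∷ ts , c))) e) , refl) })
  where
  open ≡-Reasoning
  graft₁ : ∀ (x : Vec Tree (suc (suc p)) × Context) → total (map₁ graft x) ≡ suc (total x)
  graft₁ (ts , c) = cong (_+ context-nodes c) (forest-nodes-graft ts)
  graft₁-injective : ∀ {x y : Vec Tree (suc (suc p)) × Context} → map₁ graft x ≡ map₁ graft y → x ≡ y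
  graft₁-injective {_ ∷ _ ∷ _ , _} {_ ∷ _ ∷ _ , _} refl = refl
  binomial : (suc q + suc q + p) C suc q + (q + q + suc (suc p)) C q ≡ (suc q + suc q + suc p) C suc q
  binomial = begin
    (suc q + suc q + p) C suc q + (q + q + suc (suc p)) C q
      ≡⟨ cong (λ N → (suc q + suc q + p) C suc q + N C q) (e₁ p q) ⟩
    N C suc q + N C q      ≡⟨ +-comm (N C suc q) (N C q) ⟩
    N C q + N C suc q      ≡⟨ nCk+nC[k+1]≡[n+1]C[k+1] N q ⟩
    suc N C suc q          ≡⟨ cong (_C suc q) (+-suc (suc q + suc q) p) ⟨
    (suc q + suc q + suc p) C suc q ∎
    where
    N = suc q + suc q + p
    e₁ : ∀ p q → q + q + suc (suc p) ≡ suc q + suc q + p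
    e₁ = solve-∀

-- Pruned trees in a context

sum-kept : ∀ {p} → Vec Pruned p → ℕ
sum-kept []       = 0
sum-kept (p ∷ ps) = kept p + sum-kept ps

sum-lost : ∀ {p} → Vec Pruned p → ℕ
sum-lost []       = 0
sum-lost (p ∷ ps) = lost p + sum-lost ps

-- A state in the disassembly of a pruned tree: `p` hanging subtrees already released, beside the
-- context, and `r` pruned trees still to be opened.
Stack : ℕ → ℕ → Set
Stack p r = (Vec Tree p × Context) × Vec Pruned r

HasSize : ∀ {p r} → ℕ → ℕ → Stack p r → Set
HasSize j q (x , ps) = sum-kept ps ≡ j × total x + sum-lost ps ≡ q

split : ∀ {p r} → Stack p (suc (suc r)) → Stack p (suc r)
split (x , a ∷ b ∷ ps) = x , branch a b ∷ ps

uncut : ∀ {p r} → Stack (suc p) r → Stack p (suc r)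
uncut ((t ∷ ts , c) , ps) = (ts , c) , cut t ∷ ps

split-injective : ∀ {p r} {x y : Stack p (suc (suc r))} → split x ≡ split y → x ≡ y
split-injective {x = _ , _ ∷ _ ∷ _} {y = _ , _ ∷ _ ∷ _} refl = refl

uncut-injective : ∀ {p r} {x y : Stack (suc p) r} → uncut x ≡ uncut y → x ≡ y
uncut-injective {x = (_ ∷ _ , _) , _} {y = (_ ∷ _ , _) , _} refl = refl

split-size : ∀ {p r j q} (x : Stack p (suc (suc r))) →
             (HasSize (suc j) q (split x) → HasSize j q x) × (HasSize j q x → HasSize (suc j) q (split x))
split-size (x , a ∷ b ∷ ps) =
  (λ (e , f) → trans (sym (+-assoc (kept a) _ _)) (suc-injective e)
             , trans (cong (_+_ (total x)) (sym (+-assoc (lost a) _ _))) f) ,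
  (λ (e , f) → cong suc (trans (+-assoc (kept a) _ _) e)
             , trans (cong (_+_ (total x)) (+-assoc (lost a) _ _)) f)

uncut-size : ∀ {p r j q} (x : Stack (suc p) r) →
             (HasSize j q (uncut x) → HasSize j q x) × (HasSize j q x → HasSize j q (uncut x))
uncut-size ((t ∷ ts , c) , ps) =
  (map₂ (trans (shuffle (nodes t) (forest-nodes ts) _ _))) ,
  (map₂ (trans (sym (shuffle (nodes t) (forest-nodes ts) _ _))))
  where
  shuffle : ∀ a b c d → a + b + c + d ≡ b + c + (a + d)
  shuffle = solve-∀

-- Disassembly keeps `p + r + j` fixed: releasing a cut tree moves one unit from `r` to `p`, opening
-- a branch moves one from `j` to `r`. The binomial therefore factors out, and the remaining
-- coefficient obeys the recursion of `ballot`. At the end all hanging subtrees form one forest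
-- beside the context.
count-stacks : ∀ p r j q → Count (λ (x : Stack p r) → HasSize j q x)
                                 (ballot r j * ((q + q + (p + r + j)) C q))
count-stacks p zero zero q = subst (Count _)
  (trans (cong (λ z → (q + q + z) C q) (sym (trans (+-identityʳ (p + 0)) (+-identityʳ p)))) (sym (*-identityˡ _)))
  (count-image (count-forests-context p q) (_, []) (λ { _ _ refl → refl })
    (λ e → refl , trans (+-identityʳ _) e)
    λ { {x , []} (_ , e) → x , trans (sym (+-identityʳ _)) e , refl })
count-stacks p zero (suc j) q = count-∅ λ { (_ , []) () }
count-stacks p (suc r) zero q = subst (Count _)
  (cong (λ z → 1 * ((q + q + (z + 0)) C q)) (sym (+-suc p r)))
  (count-image (count-stacks (suc p) r 0 q) uncut (λ _ _ → uncut-injective)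
    (λ {x} → proj₂ (uncut-size x))
    λ { {(ts , c) , cut t ∷ ps} e → _ , proj₁ (uncut-size ((t ∷ ts , c) , ps)) e , refl
      ; {_ , branch _ _ ∷ _} (() , _) })
count-stacks p (suc r) (suc j) q = subst (Count _) binomial
  (count-⊕ (count-stacks (suc p) r (suc j) q) (count-stacks p (suc (suc r)) j q) uncut split
    uncut-injective split-injective (λ { ((_ ∷ _ , _) , _) (_ , _ ∷ _ ∷ _) () })
    (λ {x} → proj₂ (uncut-size x)) (λ {x} → proj₂ (split-size x))
    λ { {(ts , c) , cut t ∷ ps} e → inj₁ (_ , proj₁ (uncut-size ((t ∷ ts , c) , ps)) e , refl)
      ; {x , branch a b ∷ ps} e → inj₂ (_ , proj₁ (split-size (x , a ∷ b ∷ ps)) e , refl) })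
  where
  e₁ : ∀ p r j → suc p + r + suc j ≡ p + suc r + suc j
  e₁ = solve-∀
  e₂ : ∀ p r j → p + suc (suc r) + j ≡ p + suc r + suc j
  e₂ = solve-∀
  binomial : ballot r (suc j) * ((q + q + (suc p + r + suc j)) C q) +
             ballot (suc (suc r)) j * ((q + q + (p + suc (suc r) + j)) C q) ≡
             (ballot r (suc j) + ballot (suc (suc r)) j) * ((q + q + (p + suc r + suc j)) C q)
  binomial = trans
    (cong₂ (λ y z → ballot r (suc j) * ((q + q + y) C q) + ballot (suc (suc r)) j * ((q + q + z) C q))
      (e₁ p r j) (e₂ p r j))
    (sym (*-distribʳ-+ _ (ballot r (suc j)) _))

-- The triangulation given by a tree

-- A tree with m nodes triangulates the polygon with vertices
-- a , a + 1 , … , a + m + 1 = end t a: its root is the base edge, and the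
-- apex of the triangle on the base is the common end of the two children.

end : Tree → ℕ → ℕ
end leaf       a = suc a
end (node l r) a = end r (end l a)

Base : Tree → ℕ → ℕ → ℕ → Set
Base t a i j = i ≡ a × j ≡ end t a

Edge : Tree → ℕ → ℕ → ℕ → Set
Edge leaf       a i j = Base leaf a i j
Edge (node l r) a i j = Base (node l r) a i j ⊎ Edge l a i j ⊎ Edge r (end l a) i j

end≡ : ∀ t a → end t a ≡ a + suc (nodes t)
end≡ leaf       a = sym (+-comm a 1)
end≡ (node l r) a = trans (end≡ r (end l a))
  (trans (cong (_+ suc (nodes r)) (end≡ l a)) (shuffle a (nodes l) (nodes r)))
  where
  shuffle : ∀ a x y → a + suc x + suc y ≡ a + suc (suc (x + y))
  shuffle = solve-∀

a<end : ∀ t a → a < end t a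
a<end leaf       a = ≤-refl
a<end (node l r) a = <-trans (a<end l a) (a<end r (end l a))

Base? : ∀ t a i j → Dec (Base t a i j)
Base? t a i j = (i ≟ a) ×-dec (j ≟ end t a)

Edge? : ∀ t a i j → Dec (Edge t a i j)
Edge? leaf       a i j = Base? leaf a i j
Edge? (node l r) a i j = Base? (node l r) a i j ⊎-dec Edge? l a i j ⊎-dec Edge? r (end l a) i j

Within : ℕ → ℕ → ℕ → ℕ → Set
Within a b i j = a ≤ i × i < j × j ≤ b

within-l : ∀ {a c b i j} → c ≤ b → Within a c i j → Within a b i j
within-l c≤b (x , y , z) = x , y , ≤-trans z c≤b

within-r : ∀ {a c b i j} → a ≤ c → Within c b i j → Within a b i j
within-r a≤c (x , y , z) = ≤-trans a≤c x , y , z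

within-disjoint : ∀ {a b c i j} → Within a c i j → Within c b i j → ⊥
within-disjoint (_ , i<j , j≤c) (c≤i , _) = <-irrefl refl (<-≤-trans i<j (≤-trans j≤c c≤i))

base-within : ∀ t a {i j} → Base t a i j → Within a (end t a) i j
base-within t a (refl , refl) = ≤-refl , a<end t a , ≤-refl

edge-within : ∀ t a {i j} → Edge t a i j → Within a (end t a) i j
edge-within leaf       a e               = base-within leaf a e
edge-within (node l r) a (inj₁ e)        = base-within (node l r) a e
edge-within (node l r) a (inj₂ (inj₁ e)) = within-l (<⇒≤ (a<end r _)) (edge-within l a e)
edge-within (node l r) a (inj₂ (inj₂ e)) = within-r (<⇒≤ (a<end l a)) (edge-within r _ e)

base-not-l : ∀ l r a {i j} → Base (node l r) a i j → Within a (end l a) i j → ⊥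
base-not-l l r a (refl , refl) (_ , _ , b≤c) = <-irrefl refl (<-≤-trans (a<end r _) b≤c)

base-not-r : ∀ l r a {i j} → Base (node l r) a i j → Within (end l a) (end r (end l a)) i j → ⊥
base-not-r l r a (refl , refl) (c≤a , _) = <-irrefl refl (<-≤-trans (a<end l a) c≤a)

base-edge : ∀ t a → Edge t a a (end t a)
base-edge leaf       a = refl , refl
base-edge (node l r) a = inj₁ (refl , refl)

side-edge : ∀ t a i → a ≤ i → i < end t a → Edge t a i (suc i)
side-edge leaf a i a≤i i<b = let e = ≤-antisym (≤-pred i<b) a≤i in e , cong suc e
side-edge (node l r) a i a≤i i<b with i <? end l a
... | yes i<c = inj₂ (inj₁ (side-edge l a i a≤i i<c))
... | no  i≮c = inj₂ (inj₂ (side-edge r _ i (≮⇒≥ i≮c) i<b))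

-- The base spans every other chord and the apex separates the chords of the two halves, so a
-- crossing could only occur within one half.
edge-noncrossing : ∀ t a {i j k l} → Edge t a i j → Edge t a k l → i < k → k < j → j < l → ⊥
edge-noncrossing leaf a (refl , refl) (refl , refl) i<k _ _ = <-irrefl refl i<k
edge-noncrossing t@(node _ _) a (inj₁ (refl , refl)) f _ _ j<l =
  <-irrefl refl (<-≤-trans j<l (proj₂ (proj₂ (edge-within t a f))))
edge-noncrossing t@(node _ _) a e@(inj₂ _) (inj₁ (refl , refl)) i<k _ _ =
  <-irrefl refl (<-≤-trans i<k (proj₁ (edge-within t a e)))
edge-noncrossing (node l r) a (inj₂ (inj₁ e)) (inj₂ (inj₁ f)) = edge-noncrossing l a e f
edge-noncrossing (node l r) a (inj₂ (inj₁ e)) (inj₂ (inj₂ f)) _ k<j _ =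
  <-irrefl refl (<-≤-trans k<j (≤-trans (proj₂ (proj₂ (edge-within l a e))) (proj₁ (edge-within r _ f))))
edge-noncrossing (node l r) a (inj₂ (inj₂ e)) (inj₂ (inj₁ f)) i<k k<j j<l =
  <-irrefl refl (<-≤-trans (<-trans i<k (<-trans k<j j<l))
    (≤-trans (proj₂ (proj₂ (edge-within l a f))) (proj₁ (edge-within r _ e))))
edge-noncrossing (node l r) a (inj₂ (inj₂ e)) (inj₂ (inj₂ f)) = edge-noncrossing r _ e f

edge-left : ∀ l r a {i j} → Edge (node l r) a i j → j ≤ end l a → Edge l a i j
edge-left l r a (inj₁ (refl , refl)) j≤c = ⊥-elim (<-irrefl refl (<-≤-trans (a<end r _) j≤c))
edge-left l r a (inj₂ (inj₁ e))      _   = e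
edge-left l r a (inj₂ (inj₂ e))      j≤c =
  let c≤i , i<j , _ = edge-within r _ e in ⊥-elim (<-irrefl refl (<-≤-trans i<j (≤-trans j≤c c≤i)))

edge-right : ∀ l r a {i j} → Edge (node l r) a i j → end l a ≤ i → Edge r (end l a) i j
edge-right l r a (inj₁ (refl , refl)) c≤i = ⊥-elim (<-irrefl refl (<-≤-trans (a<end l a) c≤i))
edge-right l r a (inj₂ (inj₁ e))      c≤i =
  let _ , i<j , j≤c = edge-within l a e in ⊥-elim (<-irrefl refl (<-≤-trans i<j (≤-trans j≤c c≤i)))
edge-right l r a (inj₂ (inj₂ e))      _   = e

-- Two different apexes c < c′ would give crossing edges c b and a c′.

edge-injective : ∀ t t′ a → end t a ≡ end t′ a →
                 (∀ {i j} → Edge t a i j → Edge t′ a i j) → t ≡ t′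
edge-injective leaf leaf a _ _ = refl
edge-injective leaf (node l r) a e _ =
  ⊥-elim (<-irrefl e (≤-<-trans (a<end l a) (a<end r (end l a))))
edge-injective (node l r) leaf a e _ =
  ⊥-elim (<-irrefl (sym e) (≤-<-trans (a<end l a) (a<end r (end l a))))
edge-injective t@(node l r) t′@(node l′ r′) a b≡b′ sub with <-cmp (end l a) (end l′ a)
... | tri< c<c′ _ _ = ⊥-elim (edge-noncrossing t′ a
  (inj₂ (inj₁ (base-edge l′ a))) (sub (inj₂ (inj₂ (base-edge r _))))
  (a<end l a) c<c′ (subst (end l′ a <_) (sym b≡b′) (a<end r′ _)))
... | tri> _ _ c′<c = ⊥-elim (edge-noncrossing t′ a
  (sub (inj₂ (inj₁ (base-edge l a)))) (inj₂ (inj₂ (base-edge r′ _)))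
  (a<end l′ a) c′<c (subst (end l a <_) b≡b′ (a<end r _)))
... | tri≈ _ c≡c′ _ = cong₂ node
  (edge-injective l l′ a c≡c′ λ e → edge-left l′ r′ a (sub (inj₂ (inj₁ e)))
    (≤-trans (proj₂ (proj₂ (edge-within l a e))) (≤-reflexive c≡c′)))
  (edge-injective r r′ (end l a) (trans b≡b′ (cong (end r′) (sym c≡c′))) λ {i} {j} e →
    subst (λ c → Edge r′ c i j) (sym c≡c′) (edge-right l′ r′ a (sub (inj₂ (inj₂ e)))
      (≤-trans (≤-reflexive (sym c≡c′)) (proj₁ (edge-within r _ e)))))

-- For `m` nodes these are the `m + 2` sides and `m - 1` diagonals of a polygon with `m + 2`
-- vertices; a leaf is a single edge.
edge-number : Tree → ℕ
edge-number t = suc (2 * nodes t)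

count-base : ∀ t a → Count (λ ((i , j) : ℕ × ℕ) → Base t a i j) 1
count-base t a = count-singleton (a , end t a) (refl , refl) λ { _ (refl , refl) → refl }

count-edges : ∀ t a → Count (λ ((i , j) : ℕ × ℕ) → Edge t a i j) (edge-number t)
count-edges leaf       a = count-base leaf a
count-edges (node l r) a = subst (Count _) (shuffle (nodes l) (nodes r))
  (count-⊎ (count-base (node l r) a)
    (count-⊎ (count-edges l a) (count-edges r (end l a))
      λ _ e f → within-disjoint (edge-within l a e) (edge-within r _ f))
    λ _ e → [ base-not-l l r a e ∘ edge-within l a , base-not-r l r a e ∘ edge-within r _ ]′)
  where
  shuffle : ∀ x y → 1 + (suc (2 * x) + suc (2 * y)) ≡ suc (2 * suc (x + y))
  shuffle = solve-∀

-- Completing a noncrossing set of chords to a triangulation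

module _ (R : ℕ → ℕ → Set) (R? : ∀ i j → Dec (R i j)) where

  -- The default `suc a` covers a vertex without neighbours in the range: `R` will hold diagonals
  -- only, and the side from `a` to `suc a` can always serve as a side of the triangle on the base.
  greatest-neighbour : ∀ a d → ∃ λ c → a < c × c ≤ suc a + d × (R a c ⊎ c ≡ suc a) ×
                                       (∀ y → c < y → y ≤ suc a + d → ¬ R a y)
  greatest-neighbour a zero = suc a , ≤-refl , m≤m+n _ 0 , inj₂ refl ,
    λ y c<y y≤ _ → <-irrefl refl (<-≤-trans c<y (≤-trans y≤ (≤-reflexive (+-identityʳ (suc a)))))
  greatest-neighbour a (suc d) with R? a (suc a + suc d)
  ... | yes e = suc a + suc d , m≤m+n (suc a) (suc d) , ≤-refl , inj₁ e ,
    λ y c<y y≤ _ → <-irrefl refl (<-≤-trans c<y y≤)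
  ... | no ¬e = let c , a<c , c≤ , or , none = greatest-neighbour a d in
    c , a<c , ≤-trans c≤ (+-monoʳ-≤ (suc a) (n≤1+n d)) , or , λ y c<y y≤ → beyond none y c<y (m≤n⇒m<n∨m≡n y≤)
    where
    beyond : ∀ {c} → (∀ y → c < y → y ≤ suc a + d → ¬ R a y) →
             ∀ y → c < y → y < suc a + suc d ⊎ y ≡ suc a + suc d → ¬ R a y
    beyond none y c<y (inj₁ y<)   = none y c<y (≤-pred (≤-trans y< (≤-reflexive (+-suc (suc a) d))))
    beyond none y c<y (inj₂ refl) = ¬e

  -- With c the greatest neighbour of a below b, no chord passes over c.

  extend : (∀ {i j k l} → R i j → R k l → i < k → k < j → j < l → ⊥) →
           ∀ fuel a m → m ≤ fuel → ∃ λ t → nodes t ≡ m ×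
             (∀ {i j} → R i j → Within a (a + suc m) i j → Edge t a i j)
  extend nc fuel a zero _ = leaf , refl , λ { _ (a≤i , i<j , j≤) →
    let j≤1+a = ≤-trans j≤ (≤-reflexive (+-comm a 1))
        i≡a   = ≤-antisym (≤-pred (≤-trans i<j j≤1+a)) a≤i
    in i≡a , ≤-antisym j≤1+a (≤-trans (s≤s a≤i) i<j) }
  -- The search stops at `suc a + m`, one short of the far end `b`, so that the base itself is not
  -- taken for the chord to the apex.
  extend nc (suc fuel) a (suc m) (s≤s m≤fuel) with greatest-neighbour a m
  ... | c , a<c , c≤ , or , none = node l r , nodes≡ , edge
    where
    x = c ∸ suc a
    y = suc a + m ∸ c
    b = a + suc (suc m)
    c≡ : a + suc x ≡ c
    c≡ = trans (+-suc a x) (m+[n∸m]≡n a<c)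
    x+y≡m : x + y ≡ m
    x+y≡m = +-cancelˡ-≡ (suc a) _ _ (trans (sym (+-assoc (suc a) x y))
      (trans (cong (_+ y) (m+[n∸m]≡n a<c)) (m+[n∸m]≡n c≤)))
    b≡ : c + suc y ≡ b
    b≡ = trans (+-suc c y) (trans (cong suc (m+[n∸m]≡n c≤))
      (trans (cong suc (sym (+-suc a m))) (sym (+-suc a (suc m)))))
    left  = extend nc fuel a x (≤-trans (m≤m+n x y) (≤-trans (≤-reflexive x+y≡m) m≤fuel))
    right = extend nc fuel c y (≤-trans (m≤n+m y x) (≤-trans (≤-reflexive x+y≡m) m≤fuel))
    l = proj₁ left
    r = proj₁ right
    nodes≡ : nodes (node l r) ≡ suc m
    nodes≡ = cong suc (trans (cong₂ _+_ (proj₁ (proj₂ left)) (proj₁ (proj₂ right))) x+y≡m)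
    end-l : end l a ≡ c
    end-l = trans (end≡ l a) (trans (cong (λ z → a + suc z) (proj₁ (proj₂ left))) c≡)
    end-b : end (node l r) a ≡ b
    end-b = trans (end≡ (node l r) a) (cong (λ z → a + suc z) nodes≡)
    -- A chord over `c` that starts at `a` is the base, or it contradicts the maximality of `c`. One
    -- that starts strictly between `a` and `c` crosses the chord from `a` to `c`; in the default
    -- case `c = suc a` there is no vertex between.
    over : ∀ {i j} → R i j → a < i ⊎ a ≡ i → i < c → c < j → j < b ⊎ j ≡ b → R a c ⊎ c ≡ suc a →
           i ≡ a × j ≡ b
    over e (inj₂ refl) _   _   (inj₂ refl) _           = refl , refl
    over e (inj₂ refl) _   c<j (inj₁ j<b)  _           = ⊥-elim (none _ c<j
      (≤-pred (≤-trans j<b (≤-reflexive (trans (+-suc a (suc m)) (cong suc (+-suc a m)))))) e)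
    over e (inj₁ a<i)  i<c c<j _           (inj₁ f)    = ⊥-elim (nc f e a<i i<c c<j)
    over e (inj₁ a<i)  i<c _   _           (inj₂ refl) = ⊥-elim (<-irrefl refl (<-≤-trans a<i (≤-pred i<c)))
    edge : ∀ {i j} → R i j → Within a b i j → Edge (node l r) a i j
    edge {i} {j} e (a≤i , i<j , j≤b) with j ≤? c | c ≤? i
    ... | yes j≤c | _ = inj₂ (inj₁ (proj₂ (proj₂ left) e (a≤i , i<j , ≤-trans j≤c (≤-reflexive (sym c≡)))))
    ... | no _ | yes c≤i = inj₂ (inj₂ (subst (λ z → Edge r z i j) (sym end-l)
      (proj₂ (proj₂ right) e (c≤i , i<j , ≤-trans j≤b (≤-reflexive (sym b≡))))))
    ... | no j≰c | no c≰i = let i≡a , j≡b = over e (m≤n⇒m<n∨m≡n a≤i) (≰⇒> c≰i) (≰⇒> j≰c) (m≤n⇒m<n∨m≡n j≤b) or in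
      inj₁ (i≡a , trans j≡b (sym end-b))

-- The boundary of a pruned tree in its context

-- The edges along which a pruned tree was cut: together with the base
-- edge they bound a polygon.

Frontier : Pruned → ℕ → ℕ → ℕ → Set
Frontier (cut t)      a i j = Base t a i j
Frontier (branch l r) a i j = Frontier l a i j ⊎ Frontier r (end (forget l) a) i j

Boundary : Context → Pruned → ℕ → ℕ → ℕ → Set
Boundary []                p a i j = Base (forget p) a i j ⊎ Frontier p a i j
Boundary ((false , r) ∷ c) p a i j = Boundary c p a i j
Boundary ((true  , l) ∷ c) p a i j = Boundary c p (end l a) i j

Frontier? : ∀ p a i j → Dec (Frontier p a i j)
Frontier? (cut t)      a i j = Base? t a i j
Frontier? (branch l r) a i j = Frontier? l a i j ⊎-dec Frontier? r _ i j

Boundary? : ∀ c p a i j → Dec (Boundary c p a i j)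
Boundary? []                p a i j = Base? (forget p) a i j ⊎-dec Frontier? p a i j
Boundary? ((false , r) ∷ c) p a i j = Boundary? c p a i j
Boundary? ((true  , l) ∷ c) p a i j = Boundary? c p (end l a) i j

frontier-edge : ∀ p a {i j} → Frontier p a i j → Edge (forget p) a i j
frontier-edge (cut t)      a (refl , refl) = base-edge t a
frontier-edge (branch l r) a (inj₁ e)      = inj₂ (inj₁ (frontier-edge l a e))
frontier-edge (branch l r) a (inj₂ e)      = inj₂ (inj₂ (frontier-edge r _ e))

boundary-edge : ∀ c p a {i j} → Boundary c p a i j → Edge (plug c (forget p)) a i j
boundary-edge []                p a (inj₁ (refl , refl)) = base-edge (forget p) a
boundary-edge []                p a (inj₂ e)             = frontier-edge p a e
boundary-edge ((false , r) ∷ c) p a e = inj₂ (inj₁ (boundary-edge c p a e))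
boundary-edge ((true  , l) ∷ c) p a e = inj₂ (inj₂ (boundary-edge c p (end l a) e))

frontier-within : ∀ p a {i j} → Frontier p a i j → Within a (end (forget p) a) i j
frontier-within p a = edge-within (forget p) a ∘ frontier-edge p a

boundary-within : ∀ c p a {i j} → Boundary c p a i j → Within a (end (plug c (forget p)) a) i j
boundary-within c p a = edge-within (plug c (forget p)) a ∘ boundary-edge c p a

frontier-start : ∀ p a → ∃ λ j → Frontier p a a j
frontier-start (cut t)      a = _ , refl , refl
frontier-start (branch l r) a = map₂ inj₁ (frontier-start l a)

boundary-nonempty : ∀ c p a → ∃₂ λ i j → Boundary c p a i j
boundary-nonempty []                p a = _ , _ , inj₁ (refl , refl)
boundary-nonempty ((false , r) ∷ c) p a = boundary-nonempty c p a
boundary-nonempty ((true  , l) ∷ c) p a = boundary-nonempty c p (end l a)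

node-injective : ∀ {l r l′ r′} → node l r ≡ node l′ r′ → l ≡ l′ × r ≡ r′
node-injective refl = refl , refl

frontier-left : ∀ l r a {i j} → Frontier (branch l r) a i j → j ≤ end (forget l) a → Frontier l a i j
frontier-left l r a (inj₁ e) _   = e
frontier-left l r a (inj₂ e) j≤c = let c≤i , i<j , _ = frontier-within r _ e in
  ⊥-elim (<-irrefl refl (<-≤-trans i<j (≤-trans j≤c c≤i)))

frontier-right : ∀ l r a {i j} → Frontier (branch l r) a i j → end (forget l) a ≤ i →
                 Frontier r (end (forget l) a) i j
frontier-right l r a (inj₁ e) c≤i = let _ , i<j , j≤c = frontier-within l a e in
  ⊥-elim (<-irrefl refl (<-≤-trans i<j (≤-trans j≤c c≤i)))
frontier-right l r a (inj₂ e) _   = e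

frontier-not-base : ∀ l r a {i j} → Frontier (branch l r) a i j → Base (forget (branch l r)) a i j → ⊥
frontier-not-base l r a (inj₁ e) f = base-not-l (forget l) (forget r) a f (frontier-within l a e)
frontier-not-base l r a (inj₂ e) f = base-not-r (forget l) (forget r) a f (frontier-within r _ e)

-- The base edge is in the frontier exactly when the tree is cut at its root, so the frontier shows
-- whether the root is kept. If it is, the apex separates the frontiers of the two children.
frontier-injective : ∀ p p′ a → forget p ≡ forget p′ →
                     (∀ {i j} → Frontier p a i j → Frontier p′ a i j) → p ≡ p′
frontier-injective (cut t) (cut t′) a eq _ = cong cut eq
frontier-injective (cut t) (branch l r) a refl sub =
  ⊥-elim (frontier-not-base l r a (sub (refl , refl)) (refl , refl))
frontier-injective (branch l r) (cut t) a refl sub = let j , e = frontier-start l a in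
  ⊥-elim (frontier-not-base l r a (inj₁ e) (sub (inj₁ e)))
frontier-injective (branch l r) (branch l′ r′) a eq sub = cong₂ branch
  (frontier-injective l l′ a (proj₁ eqs) λ e → frontier-left l′ r′ a (sub (inj₁ e))
    (≤-trans (proj₂ (proj₂ (frontier-within l a e))) (≤-reflexive c≡c′)))
  (frontier-injective r r′ _ (proj₂ eqs) λ {i} {j} e → subst (λ c → Frontier r′ c i j) (sym c≡c′)
    (frontier-right l′ r′ a (sub (inj₂ e)) (≤-trans (≤-reflexive (sym c≡c′)) (proj₁ (frontier-within r _ e)))))
  where
  eqs = node-injective eq
  c≡c′ = cong (λ t → end t a) (proj₁ eqs)

-- Excludes the degenerate case without triangles, whose boundary is a single chord and no polygon.
Branched : Pruned → Set
Branched p = 0 < kept p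

-- The boundary lies within the interval of the marked subtree and contains the base of that
-- interval. It fits into a half only if the context descends there: the base of the whole tree lies
-- in neither half, and the halves share no edge.
boundary-injective : ∀ c p c′ p′ a → Branched p → Branched p′ →
                     plug c (forget p) ≡ plug c′ (forget p′) →
                     (∀ {i j} → Boundary c p a i j → Boundary c′ p′ a i j) →
                     (∀ {i j} → Boundary c′ p′ a i j → Boundary c p a i j) →
                     (c , p) ≡ (c′ , p′)
boundary-injective [] p@(branch l r) [] p′@(branch l′ r′) a _ _ eq sub sup =
  cong ([] ,_) (frontier-injective p p′ a eq λ e → [ not-base e , id ]′ (sub (inj₂ e)))
  where
  not-base : ∀ {i j} → Frontier p a i j → Base (forget p′) a i j → Frontier p′ a i j
  not-base e (i≡ , j≡) = ⊥-elim (frontier-not-base l r a e (i≡ , trans j≡ (cong (λ t → end t a) (sym eq))))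
boundary-injective [] p@(branch l r) ((false , r′) ∷ c′) p′ a _ _ eq sub sup =
  ⊥-elim (base-not-l (plug c′ (forget p′)) r′ a (refl , cong (λ t → end t a) eq)
    (boundary-within c′ p′ a (sub (inj₁ (refl , refl)))))
boundary-injective [] p@(branch l r) ((true , l′) ∷ c′) p′ a _ _ eq sub sup =
  ⊥-elim (base-not-r l′ (plug c′ (forget p′)) a (refl , cong (λ t → end t a) eq)
    (boundary-within c′ p′ _ (sub (inj₁ (refl , refl)))))
boundary-injective ((false , r) ∷ c) p [] p′ a _ _ eq sub sup =
  ⊥-elim (base-not-l (plug c (forget p)) r a (refl , cong (λ t → end t a) (sym eq))
    (boundary-within c p a (sup (inj₁ (refl , refl)))))
boundary-injective ((true , l) ∷ c) p [] p′ a _ _ eq sub sup =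
  ⊥-elim (base-not-r l (plug c (forget p)) a (refl , cong (λ t → end t a) (sym eq))
    (boundary-within c p _ (sup (inj₁ (refl , refl)))))
boundary-injective ((false , r) ∷ c) p ((false , r′) ∷ c′) p′ a b b′ eq sub sup
  with refl ← boundary-injective c p c′ p′ a b b′ (proj₁ (node-injective eq)) sub sup =
  cong (λ s → (false , s) ∷ c , p) (proj₂ (node-injective eq))
boundary-injective ((true , l) ∷ c) p ((true , l′) ∷ c′) p′ a b b′ eq sub sup
  with refl ← proj₁ (node-injective eq)
  with refl ← boundary-injective c p c′ p′ (end l a) b b′ (proj₂ (node-injective eq)) sub sup = refl
boundary-injective ((false , r) ∷ c) p ((true , l) ∷ c′) p′ a _ _ eq sub sup =
  let _ , _ , e = boundary-nonempty c p a in ⊥-elim (within-disjoint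
    (subst (λ t → Within a (end t a) _ _) (proj₁ (node-injective eq)) (boundary-within c p a e))
    (boundary-within c′ p′ _ (sub e)))
boundary-injective ((true , l) ∷ c) p ((false , r) ∷ c′) p′ a _ _ eq sub sup =
  let _ , _ , e = boundary-nonempty c p (end l a) in ⊥-elim (within-disjoint
    (subst (λ t → Within a (end t a) _ _) (sym (proj₁ (node-injective eq))) (boundary-within c′ p′ a (sub e)))
    (boundary-within c p _ e))

-- Steps of open and closed walks

module _ {A : Set} where

  pairs : List A → List (A × A)
  pairs []           = []
  pairs (x ∷ [])     = []
  pairs (x ∷ y ∷ ys) = (x , y) ∷ pairs (y ∷ ys)

  closed-pairs : List A → List (A × A)
  closed-pairs []       = []
  closed-pairs (x ∷ xs) = pairs (x ∷ xs ++ x ∷ [])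

  pairs-++ : ∀ xs z ys → pairs (xs ++ z ∷ ys) ≡ pairs (xs ++ z ∷ []) ++ pairs (z ∷ ys)
  pairs-++ []            z ys = refl
  pairs-++ (x ∷ [])      z ys = refl
  pairs-++ (x ∷ x′ ∷ xs) z ys = cong ((x , x′) ∷_) (pairs-++ (x′ ∷ xs) z ys)

  pairs-∈ : ∀ xs {x y} → (x , y) ∈ pairs xs → x ∈ xs × y ∈ xs
  pairs-∈ (z ∷ z′ ∷ xs) (here refl) = here refl , there (here refl)
  pairs-∈ (z ∷ z′ ∷ xs) (there m)   = let p , q = pairs-∈ (z′ ∷ xs) m in there p , there q

  pairs-∈-tail : ∀ z xs {x y} → (x , y) ∈ pairs (z ∷ xs) → y ∈ xs
  pairs-∈-tail z (z′ ∷ xs) (here refl) = here refl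
  pairs-∈-tail z (z′ ∷ xs) (there m)   = there (pairs-∈-tail z′ xs m)

  closed-pairs-∈ : ∀ xs {x y} → (x , y) ∈ closed-pairs xs → x ∈ xs × y ∈ xs
  closed-pairs-∈ (z ∷ xs) m = let p , q = pairs-∈ (z ∷ xs ++ z ∷ []) m in back p , back q
    where
    back : ∀ {x} → x ∈ z ∷ xs ++ z ∷ [] → x ∈ z ∷ xs
    back p with ∈-++⁻ (z ∷ xs) p
    ... | inj₁ q           = q
    ... | inj₂ (here refl) = here refl

  pairs-++⁺ˡ : ∀ xs ys {e} → e ∈ pairs xs → e ∈ pairs (xs ++ ys)
  pairs-++⁺ˡ (x ∷ x′ ∷ xs) ys (here refl) = here refl
  pairs-++⁺ˡ (x ∷ x′ ∷ xs) ys (there m)   = there (pairs-++⁺ˡ (x′ ∷ xs) ys m)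

  pairs-∷⁺ : ∀ x xs {e} → e ∈ pairs xs → e ∈ pairs (x ∷ xs)
  pairs-∷⁺ x (_ ∷ _) m = there m

  pairs-⊆-closed : ∀ xs {e} → e ∈ pairs xs → e ∈ closed-pairs xs
  pairs-⊆-closed (x ∷ xs) = pairs-++⁺ˡ (x ∷ xs) (x ∷ [])

  -- The first vertices of the two pieces cut the closed walk into two arcs, and rotation only swaps
  -- the arcs.
  closed-pairs-rotate : ∀ xs ys {e} → e ∈ closed-pairs (xs ++ ys) → e ∈ closed-pairs (ys ++ xs)
  closed-pairs-rotate []       ys       m = subst (λ zs → _ ∈ closed-pairs zs) (sym (++-identityʳ ys)) m
  closed-pairs-rotate (x ∷ xs) []   {e} m = subst (λ zs → e ∈ closed-pairs zs) (++-identityʳ (x ∷ xs)) m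
  closed-pairs-rotate (x ∷ xs) (y ∷ ys) m = subst (_ ∈_) (sym (cut-at y ys x xs))
    ([ ∈-++⁺ʳ (pairs (y ∷ ys ++ x ∷ [])) , ∈-++⁺ˡ ]′
      (∈-++⁻ (pairs (x ∷ xs ++ y ∷ [])) (subst (_ ∈_) (cut-at x xs y ys) m)))
    where
    cut-at : ∀ x xs y ys → closed-pairs ((x ∷ xs) ++ y ∷ ys) ≡
                           pairs (x ∷ xs ++ y ∷ []) ++ pairs (y ∷ ys ++ x ∷ [])
    cut-at x xs y ys = trans (cong (pairs ∘ (x ∷_)) (++-assoc xs (y ∷ ys) (x ∷ [])))
                             (pairs-++ (x ∷ xs) y (ys ++ x ∷ []))

  pairs-reverse : ∀ xs {x y} → (x , y) ∈ pairs xs → (y , x) ∈ pairs (reverse xs)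
  pairs-reverse (z ∷ z′ ∷ xs) m = subst (_ ∈_) (sym eq) (go m)
    where
    eq : pairs (reverse (z ∷ z′ ∷ xs)) ≡ pairs (reverse (z′ ∷ xs)) ++ (z′ , z) ∷ []
    eq = trans (cong pairs (trans (unfold-reverse z (z′ ∷ xs))
           (trans (cong (_++ z ∷ []) (unfold-reverse z′ xs)) (++-assoc (reverse xs) _ _))))
         (trans (pairs-++ (reverse xs) z′ (z ∷ []))
                (cong (λ zs → pairs zs ++ (z′ , z) ∷ []) (sym (unfold-reverse z′ xs))))
    go : ∀ {x y} → (x , y) ∈ pairs (z ∷ z′ ∷ xs) → (y , x) ∈ pairs (reverse (z′ ∷ xs)) ++ (z′ , z) ∷ []
    go (here refl) = ∈-++⁺ʳ (pairs (reverse (z′ ∷ xs))) (here refl)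
    go (there m)   = ∈-++⁺ˡ (pairs-reverse (z′ ∷ xs) m)

  closed-pairs-reverse : ∀ xs {x y} → (x , y) ∈ closed-pairs xs → (y , x) ∈ closed-pairs (reverse xs)
  closed-pairs-reverse (z ∷ xs) m = subst (λ zs → _ ∈ closed-pairs zs) (sym (unfold-reverse z xs))
    (closed-pairs-rotate (z ∷ []) (reverse xs) (subst (λ zs → _ ∈ pairs zs)
      (trans (reverse-++ (z ∷ xs) (z ∷ [])) (cong (z ∷_) (unfold-reverse z xs)))
      (pairs-reverse (z ∷ xs ++ z ∷ []) m)))

  unique-++⁻ : ∀ xs {ys : List A} → Unique (xs ++ ys) → Unique xs × Unique ys × (∀ {x} → x ∈ xs → x ∉ ys)
  unique-++⁻ []       u        = [] , u , λ ()
  unique-++⁻ (x ∷ xs) (x∉ ∷ u) = let u₁ , u₂ , disj = unique-++⁻ xs u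
                                     x∉₁ , x∉₂ = All.++⁻ xs x∉ in
    x∉₁ ∷ u₁ , u₂ , λ { (here refl) m → All.lookup x∉₂ m refl ; (there m) → disj m }

  unique-resp-↭ : ∀ {xs ys : List A} → xs ↭ ys → Unique xs → Unique ys
  unique-resp-↭ p = SetoidPerm.Unique-resp-↭ (setoid A) (↭⇒↭ₛ p)

  -- Used with `y` equal to `b`: a simple closed walk that starts at `b` enters `b` only by its
  -- closing step, whose source is the last vertex.
  last-pair : ∀ y zs {a b} → b ∉ zs → (a , b) ∈ pairs (y ∷ zs ++ b ∷ []) → ∃ λ ws → y ∷ zs ≡ ws ++ a ∷ []
  last-pair y []       b∉ (here refl) = [] , refl
  last-pair y (z ∷ zs) b∉ (here refl) = ⊥-elim (b∉ (here refl))
  last-pair y (z ∷ zs) b∉ (there m)   = let ws , eq = last-pair z zs (b∉ ∘ there) m in y ∷ ws , cong (y ∷_) eq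

-- Simple paths between the ends of the base

-- Edges are stored in increasing direction, while a walk may traverse them either way.
Link : (ℕ → ℕ → Set) → ℕ → ℕ → Set
Link R x y = R x y ⊎ R y x

-- The frontier is a path from `a` to the end of the tree; these are its intermediate vertices, the
-- apexes of the kept triangles.
inner : Pruned → ℕ → List ℕ
inner (cut _)      a = []
inner (branch l r) a = inner l a ++ end (forget l) a ∷ inner r (end (forget l) a)

length-inner : ∀ p a → length (inner p a) ≡ kept p
length-inner (cut _)      a = refl
length-inner (branch l r) a = trans (length-++ (inner l a))
  (trans (cong₂ _+_ (length-inner l a) (cong suc (length-inner r _))) (+-suc (kept l) (kept r)))

pairs-inner : ∀ p a → let path = a ∷ inner p a ++ end (forget p) a ∷ [] in ∀ {i j} →
              ((i , j) ∈ pairs path → Frontier p a i j) × (Frontier p a i j → (i , j) ∈ pairs path)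
pairs-inner (cut t)      a = (λ { (here refl) → refl , refl }) , λ { (refl , refl) → here refl }
pairs-inner (branch l r) a =
  (λ m → Sum.map (proj₁ (pairs-inner l a)) (proj₁ (pairs-inner r _))
           (∈-++⁻ (pairs (a ∷ inner l a ++ c ∷ [])) (subst (_ ∈_) eq m))) ,
  λ f → subst (_ ∈_) (sym eq) ([ (λ g → ∈-++⁺ˡ (proj₂ (pairs-inner l a) g))
                              , (λ g → ∈-++⁺ʳ _ (proj₂ (pairs-inner r c) g)) ]′ f)
  where
  c = end (forget l) a
  b = end (forget r) c
  eq : pairs (a ∷ inner (branch l r) a ++ b ∷ []) ≡
       pairs (a ∷ inner l a ++ c ∷ []) ++ pairs (c ∷ inner r c ++ b ∷ [])
  eq = trans (cong (pairs ∘ (a ∷_)) (++-assoc (inner l a) (c ∷ inner r c) (b ∷ [])))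
             (pairs-++ (a ∷ inner l a) c (inner r c ++ b ∷ []))

module _ (l r : Tree) (a : ℕ) where

  private
    c = end l a

  -- Adjacency after removal of the base: two graphs that share only the vertex `c`.
  HalfLink : ℕ → ℕ → Set
  HalfLink x y = Link (Edge l a) x y ⊎ Link (Edge r c) x y

  halve : ∀ {x y} → ¬ Base (node l r) a x y → ¬ Base (node l r) a y x →
          Link (Edge (node l r) a) x y → HalfLink x y
  halve ¬e ¬f (inj₁ (inj₁ e))        = ⊥-elim (¬e e)
  halve ¬e ¬f (inj₁ (inj₂ (inj₁ e))) = inj₁ (inj₁ e)
  halve ¬e ¬f (inj₁ (inj₂ (inj₂ e))) = inj₂ (inj₁ e)
  halve ¬e ¬f (inj₂ (inj₁ e))        = ⊥-elim (¬f e)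
  halve ¬e ¬f (inj₂ (inj₂ (inj₁ e))) = inj₁ (inj₂ e)
  halve ¬e ¬f (inj₂ (inj₂ (inj₂ e))) = inj₂ (inj₂ e)

  link-left : ∀ {x y} → HalfLink x y → x ≤ c → y ≤ c → Link (Edge l a) x y
  link-left (inj₁ e)        _   _   = e
  link-left (inj₂ (inj₁ e)) _   y≤c = let c≤x , x<y , _ = edge-within r c e in
    ⊥-elim (<-irrefl refl (<-≤-trans x<y (≤-trans y≤c c≤x)))
  link-left (inj₂ (inj₂ e)) x≤c _   = let c≤y , y<x , _ = edge-within r c e in
    ⊥-elim (<-irrefl refl (<-≤-trans y<x (≤-trans x≤c c≤y)))

  link-right : ∀ {x y} → HalfLink x y → c ≤ x → c ≤ y → Link (Edge r c) x y
  link-right (inj₂ e)        _   _   = e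
  link-right (inj₁ (inj₁ e)) c≤x _   = let _ , x<y , y≤c = edge-within l a e in
    ⊥-elim (<-irrefl refl (<-≤-trans x<y (≤-trans y≤c c≤x)))
  link-right (inj₁ (inj₂ e)) _   c≤y = let _ , y<x , x≤c = edge-within l a e in
    ⊥-elim (<-irrefl refl (<-≤-trans y<x (≤-trans x≤c c≤y)))

  not-across : ∀ {x y} → HalfLink x y → x < c → c < y → ⊥
  not-across (inj₁ (inj₁ e)) _   c<y = <-irrefl refl (<-≤-trans c<y (proj₂ (proj₂ (edge-within l a e))))
  not-across (inj₁ (inj₂ e)) x<c c<y = let _ , y<x , x≤c = edge-within l a e in
    <-irrefl refl (<-trans c<y (<-≤-trans y<x x≤c))
  not-across (inj₂ (inj₁ e)) x<c _   = <-irrefl refl (<-≤-trans x<c (proj₁ (edge-within r c e)))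
  not-across (inj₂ (inj₂ e)) x<c c<y = let c≤y , y<x , _ = edge-within r c e in
    <-irrefl refl (<-trans x<c (<-trans c<y y<x))

  halflink-sym : ∀ {x y} → HalfLink x y → HalfLink y x
  halflink-sym = Sum.map Sum.swap Sum.swap

  -- The apex is a cut vertex of the two halves.

  one-side : ∀ xs → c ∉ xs → (∀ {x y} → (x , y) ∈ pairs xs → HalfLink x y) →
             All (_< c) xs ⊎ All (c <_) xs
  one-side []           c∉ links = inj₁ []
  one-side (x ∷ [])     c∉ links with <-cmp x c
  ... | tri< x<c _ _  = inj₁ (x<c ∷ [])
  ... | tri≈ _ refl _ = ⊥-elim (c∉ (here refl))
  ... | tri> _ _ c<x  = inj₂ (c<x ∷ [])
  one-side (x ∷ y ∷ xs) c∉ links with one-side (y ∷ xs) (c∉ ∘ there) (links ∘ there) | <-cmp x c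
  ... | _                 | tri≈ _ refl _ = ⊥-elim (c∉ (here refl))
  ... | inj₁ all          | tri< x<c _ _  = inj₁ (x<c ∷ all)
  ... | inj₂ all          | tri> _ _ c<x  = inj₂ (c<x ∷ all)
  ... | inj₁ (y<c ∷ _)    | tri> _ _ c<x  = ⊥-elim (not-across (halflink-sym (links (here refl))) y<c c<x)
  ... | inj₂ (c<y ∷ _)    | tri< x<c _ _  = ⊥-elim (not-across (links (here refl)) x<c c<y)

open DecMembership _≟_ using () renaming (_∈?_ to _∈ℕ?_)

module _ (l r : Tree) (a : ℕ) where

  private
    c = end l a
    b = end r c

  -- A simple path from `a` to `b` with an intermediate vertex cannot use the base: going from `a`
  -- to `b` at once would skip `w`, and any other use would visit `a` again.
  path-halves : ∀ w ws → Unique (a ∷ (w ∷ ws) ++ b ∷ []) →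
    (∀ {x y} → (x , y) ∈ pairs (a ∷ (w ∷ ws) ++ b ∷ []) → Link (Edge (node l r) a) x y) →
    ∀ {x y} → (x , y) ∈ pairs (a ∷ (w ∷ ws) ++ b ∷ []) → HalfLink l r a x y
  path-halves w ws (a∉ ∷ w∉ ∷ u) links {x} {y} m = halve l r a
    (λ { (refl , refl) → first m }) (λ { (refl , refl) → All.lookup a∉ (pairs-∈-tail a _ m) refl }) (links m)
    where
    first : (a , b) ∉ pairs (a ∷ (w ∷ ws) ++ b ∷ [])
    first (here refl) = All.lookup w∉ (∈-++⁺ʳ ws (here refl)) refl
    first (there m)   = All.lookup a∉ (proj₁ (pairs-∈ _ m)) refl

  -- A path avoiding `c` would stay on one side of it, but `a` lies below `c` and `b` above. Split
  -- at `c`, each part meets `c` only at its end and so remains in one half.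
  through-apex : ∀ xs → Unique (a ∷ xs ++ b ∷ []) →
    (∀ {x y} → (x , y) ∈ pairs (a ∷ xs ++ b ∷ []) → HalfLink l r a x y) →
    ∃₂ λ us vs → xs ≡ us ++ c ∷ vs ×
      Unique (a ∷ us ++ c ∷ []) × Unique (c ∷ vs ++ b ∷ []) ×
      (∀ {x y} → (x , y) ∈ pairs (a ∷ us ++ c ∷ []) → Link (Edge l a) x y) ×
      (∀ {x y} → (x , y) ∈ pairs (c ∷ vs ++ b ∷ []) → Link (Edge r c) x y)
  through-apex xs u links with c ∈ℕ? xs
  ... | no c∉ = ⊥-elim ([ (λ all → <-asym (All.lookup all (∈-++⁺ʳ (a ∷ xs) (here refl))) (a<end r c))
                        , (λ all → <-asym (All.lookup all (here refl)) (a<end l a)) ]′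
                        (one-side l r a (a ∷ xs ++ b ∷ []) avoid links))
    where
    avoid : c ∉ a ∷ xs ++ b ∷ []
    avoid (here e) = <-irrefl (sym e) (a<end l a)
    avoid (there m) with ∈-++⁻ xs m
    ... | inj₁ m′       = c∉ m′
    ... | inj₂ (here e) = <-irrefl e (a<end r c)
  ... | yes c∈ with us , vs , refl ← ∈-∃++ c∈ =
    us , vs , refl , proj₁ u-split , u₂ , left , right
    where
    assoc₁ : (a ∷ us ++ c ∷ vs) ++ b ∷ [] ≡ (a ∷ us) ++ c ∷ vs ++ b ∷ []
    assoc₁ = ++-assoc (a ∷ us) (c ∷ vs) (b ∷ [])
    assoc₂ : (a ∷ us ++ c ∷ vs) ++ b ∷ [] ≡ (a ∷ us ++ c ∷ []) ++ vs ++ b ∷ []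
    assoc₂ = trans assoc₁ (sym (++-assoc (a ∷ us) (c ∷ []) (vs ++ b ∷ [])))
    u-split = unique-++⁻ (a ∷ us ++ c ∷ []) (subst Unique assoc₂ u)
    u-split′ = unique-++⁻ (a ∷ us) (subst Unique assoc₁ u)
    u₂ = proj₁ (proj₂ u-split′)
    split-pairs : pairs ((a ∷ us ++ c ∷ vs) ++ b ∷ []) ≡
                  pairs (a ∷ us ++ c ∷ []) ++ pairs (c ∷ vs ++ b ∷ [])
    split-pairs = trans (cong pairs assoc₁) (pairs-++ (a ∷ us) c (vs ++ b ∷ []))
    links₁ : ∀ {x y} → (x , y) ∈ pairs (a ∷ us ++ c ∷ []) → HalfLink l r a x y
    links₁ m = links (subst (_ ∈_) (sym split-pairs) (∈-++⁺ˡ m))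
    links₂ : ∀ {x y} → (x , y) ∈ pairs (c ∷ vs ++ b ∷ []) → HalfLink l r a x y
    links₂ m = links (subst (_ ∈_) (sym split-pairs) (∈-++⁺ʳ _ m))
    low : All (_≤ c) (a ∷ us ++ c ∷ [])
    low with one-side l r a (a ∷ us) (λ m → proj₂ (proj₂ u-split′) m (here refl))
                      (λ m → links₁ (pairs-++⁺ˡ (a ∷ us) (c ∷ []) m))
    ... | inj₁ all       = All.++⁺ (All.map <⇒≤ all) (≤-refl ∷ [])
    ... | inj₂ (c<a ∷ _) = ⊥-elim (<-asym c<a (a<end l a))
    high : All (c ≤_) (c ∷ vs ++ b ∷ [])
    high with one-side l r a (vs ++ b ∷ []) (Uniq.Unique[x∷xs]⇒x∉xs u₂) (λ m → links₂ (pairs-∷⁺ c _ m))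
    ... | inj₁ all = ⊥-elim (<-asym (All.lookup all (∈-++⁺ʳ vs (here refl))) (a<end r c))
    ... | inj₂ all = ≤-refl ∷ All.map <⇒≤ all
    left : ∀ {x y} → (x , y) ∈ pairs (a ∷ us ++ c ∷ []) → Link (Edge l a) x y
    left m = let p , q = pairs-∈ _ m in link-left l r a (links₁ m) (All.lookup low p) (All.lookup low q)
    right : ∀ {x y} → (x , y) ∈ pairs (c ∷ vs ++ b ∷ []) → Link (Edge r c) x y
    right m = let p , q = pairs-∈ _ m in link-right l r a (links₂ m) (All.lookup high p) (All.lookup high q)

-- A path consisting of the base alone means that the tree is cut here. Otherwise the path splits at
-- the apex, and the prunings of the two children are joined by `branch`.
simple-path : ∀ t a ws → Unique (a ∷ ws ++ end t a ∷ []) →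
  (∀ {x y} → (x , y) ∈ pairs (a ∷ ws ++ end t a ∷ []) → Link (Edge t a) x y) →
  ∃ λ p → forget p ≡ t × ws ≡ inner p a
simple-path t          a []       u links = cut t , refl , refl
simple-path leaf       a (w ∷ ws) (a∉ ∷ w∉ ∷ _) links with links (here refl)
... | inj₁ (_ , w≡b) = ⊥-elim (All.lookup w∉ (∈-++⁺ʳ ws (here refl)) w≡b)
... | inj₂ (w≡a , _) = ⊥-elim (All.lookup a∉ (here refl) (sym w≡a))
simple-path (node l r) a (w ∷ ws) u links
  with us , vs , eq , u₁ , u₂ , links₁ , links₂ ← through-apex l r a (w ∷ ws) u (path-halves l r a w ws u links)
  with pˡ , refl , refl ← simple-path l a us u₁ links₁
  with pʳ , refl , refl ← simple-path r (end l a) vs u₂ links₂ = branch pˡ pʳ , refl , eq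

-- Every cycle is a boundary

polygon : Context → Pruned → ℕ → List ℕ
polygon []                p a = a ∷ inner p a ++ end (forget p) a ∷ []
polygon ((false , r) ∷ c) p a = polygon c p a
polygon ((true  , l) ∷ c) p a = polygon c p (end l a)

length-polygon : ∀ c p a → length (polygon c p a) ≡ 2 + kept p
length-polygon []                p a = cong suc (trans (length-++ (inner p a))
  (trans (+-comm _ 1) (cong suc (length-inner p a))))
length-polygon ((false , r) ∷ c) p a = length-polygon c p a
length-polygon ((true  , l) ∷ c) p a = length-polygon c p (end l a)

inner-sorted : ∀ p a → AllPairs _<_ (a ∷ inner p a ++ end (forget p) a ∷ [])
inner-sorted (cut t)      a = (a<end t a ∷ []) ∷ [] ∷ []
inner-sorted (branch l r) a = subst (AllPairs _<_) (sym (++-assoc (a ∷ inner l a) (c ∷ inner r c) (b ∷ [])))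
  (sorted-++ (a ∷ inner l a) (inner-sorted l a) (inner-sorted r c))
  where
  c = end (forget l) a
  b = end (forget r) c
  sorted-++ : ∀ xs {z zs} → AllPairs _<_ (xs ++ z ∷ []) → AllPairs _<_ (z ∷ zs) → AllPairs _<_ (xs ++ z ∷ zs)
  sorted-++ []       _        s          = s
  sorted-++ (x ∷ xs) (x< ∷ u) s@(z< ∷ _) with x<₁ , x<z ∷ [] ← All.++⁻ xs x< =
    All.++⁺ x<₁ (x<z ∷ All.map (<-trans x<z) z<) ∷ sorted-++ xs u s

polygon-unique : ∀ c p a → Unique (polygon c p a)
polygon-unique []                p a = AllPairs.map <⇒≢ (inner-sorted p a)
polygon-unique ((false , r) ∷ c) p a = polygon-unique c p a
polygon-unique ((true  , l) ∷ c) p a = polygon-unique c p (end l a)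

Traces : Context → Pruned → ℕ → List ℕ → Set
Traces c p a xs = (∀ {i j} → (i , j) ∈ closed-pairs xs → Link (Boundary c p a) i j) ×
                  (∀ {i j} → Boundary c p a i j → Link (λ x y → (x , y) ∈ closed-pairs xs) i j)

polygon-traces : ∀ c p a → Traces c p a (polygon c p a)
polygon-traces ((false , r) ∷ c) p a = polygon-traces c p a
polygon-traces ((true  , l) ∷ c) p a = polygon-traces c p (end l a)
polygon-traces []                p a =
  (λ m → [ (λ m → inj₁ (inj₂ (proj₁ (pairs-inner p a) m)))
         , (λ { (here refl) → inj₂ (inj₁ (refl , refl)) }) ]′
         (∈-++⁻ (pairs (a ∷ inner p a ++ b ∷ [])) (subst (_ ∈_) eq m))) ,
  [ (λ { (refl , refl) → inj₂ (subst ((b , a) ∈_) (sym eq) (∈-++⁺ʳ _ (here refl))) })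
  , (λ f → inj₁ (subst (_ ∈_) (sym eq) (∈-++⁺ˡ (proj₂ (pairs-inner p a) f)))) ]′
  where
  b = end (forget p) a
  eq : closed-pairs (a ∷ inner p a ++ b ∷ []) ≡ pairs (a ∷ inner p a ++ b ∷ []) ++ (b , a) ∷ []
  eq = trans (cong (pairs ∘ (a ∷_)) (++-assoc (inner p a) (b ∷ []) (a ∷ [])))
             (pairs-++ (a ∷ inner p a) b (a ∷ []))

IsBoundary : Tree → ℕ → List ℕ → Set
IsBoundary t a xs = ∃₂ λ c p → plug c (forget p) ≡ t × length xs ≡ 2 + kept p × Traces c p a xs

-- Being a boundary depends only on the length and the unoriented steps, so a cycle may be rotated
-- and reversed at will.
boundary-resp : ∀ {t a} xs ys → length xs ≡ length ys →
  (∀ {i j} → (i , j) ∈ closed-pairs xs → Link (λ x y → (x , y) ∈ closed-pairs ys) i j) →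
  (∀ {i j} → (i , j) ∈ closed-pairs ys → Link (λ x y → (x , y) ∈ closed-pairs xs) i j) →
  IsBoundary t a ys → IsBoundary t a xs
boundary-resp xs ys len to from (c , p , eq , len′ , sub , sup) =
  c , p , eq , trans len len′ ,
  (λ m → [ sub , Sum.swap ∘ sub ]′ (to m)) ,
  (λ f → [ from , Sum.swap ∘ from ]′ (sup f))

-- Rotated to start at `a`, the cycle ends at `b` and closes along the base. What remains is a
-- simple path from `a` to `b`, classified by `simple-path`; the context is empty.
cycle-through-base : ∀ t a xs → Unique xs → 3 ≤ length xs →
  (∀ {x y} → (x , y) ∈ closed-pairs xs → Link (Edge t a) x y) →
  (end t a , a) ∈ closed-pairs xs → IsBoundary t a xs
cycle-through-base t a xs u len links m
  with us , vs , refl ← ∈-∃++ (proj₂ (closed-pairs-∈ xs m)) =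
  boundary-resp (us ++ a ∷ vs) (a ∷ vs ++ us) len≡
    (λ m → inj₁ (closed-pairs-rotate us (a ∷ vs) m))
    (λ m → inj₁ (closed-pairs-rotate (a ∷ vs) us m))
    (rotated (a ∷ vs ++ us) refl (unique-resp-↭ (++-comm us (a ∷ vs)) u) (≤-trans len (≤-reflexive len≡))
      (links ∘ closed-pairs-rotate (a ∷ vs) us) (closed-pairs-rotate us (a ∷ vs) m))
  where
  len≡ = ↭-length (++-comm us (a ∷ vs))
  b = end t a
  rotated : ∀ ys {zs} → ys ≡ a ∷ zs → Unique ys → 3 ≤ length ys →
    (∀ {x y} → (x , y) ∈ closed-pairs ys → Link (Edge t a) x y) →
    (b , a) ∈ closed-pairs ys → IsBoundary t a ys
  rotated ys {zs} refl u len links m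
    with last-pair a zs (Uniq.Unique[x∷xs]⇒x∉xs u) m
  ... | []     , eq with s≤s () ← subst (λ ys → 3 ≤ length ys) eq len
  ... | _ ∷ ws , eq with refl ← ∷-injectiveˡ eq with refl ← ∷-injectiveʳ eq =
    result (simple-path t a ws u λ m → links (pairs-⊆-closed (a ∷ ws ++ b ∷ []) m))
    where
    result : (∃ λ p → forget p ≡ t × ws ≡ inner p a) → IsBoundary t a (a ∷ ws ++ b ∷ [])
    result (p , refl , refl) = [] , p , refl , length-polygon [] p a , polygon-traces [] p a

cycle-through-base′ : ∀ t a xs → Unique xs → 3 ≤ length xs →
  (∀ {x y} → (x , y) ∈ closed-pairs xs → Link (Edge t a) x y) →
  (a , end t a) ∈ closed-pairs xs → IsBoundary t a xs
cycle-through-base′ t a xs u len links m = boundary-resp xs (reverse xs) (sym (length-reverse xs))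
  (inj₂ ∘ closed-pairs-reverse xs) (inj₂ ∘ unreverse)
  (cycle-through-base t a (reverse xs) (unique-resp-↭ (↭-sym (↭-reverse xs)) u)
    (≤-trans len (≤-reflexive (sym (length-reverse xs)))) (Sum.swap ∘ links ∘ unreverse)
    (closed-pairs-reverse xs m))
  where
  unreverse : ∀ {x y} → (x , y) ∈ closed-pairs (reverse xs) → (y , x) ∈ closed-pairs xs
  unreverse m = subst (λ zs → _ ∈ closed-pairs zs) (reverse-involutive xs) (closed-pairs-reverse (reverse xs) m)

open DecMembership (≡-dec _≟_ _≟_) using () renaming (_∈?_ to _∈ℕ²?_)

-- A cycle meets the cut vertex at most once. With that vertex rotated to the front, the others form
-- a path avoiding it, which stays on one side.
weak-side : ∀ l r a xs → Unique xs → (∀ {x y} → (x , y) ∈ closed-pairs xs → HalfLink l r a x y) →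
            All (_≤ end l a) xs ⊎ All (end l a ≤_) xs
weak-side l r a xs u links with end l a ∈ℕ? xs
... | no c∉ = Sum.map (All.map <⇒≤) (All.map <⇒≤) (one-side l r a xs c∉ (links ∘ pairs-⊆-closed xs))
... | yes c∈ with us , vs , refl ← ∈-∃++ c∈ =
  Sum.map (λ all → back (≤-refl ∷ All.map <⇒≤ all)) (λ all → back (≤-refl ∷ All.map <⇒≤ all))
    (one-side l r a (vs ++ us)
      (Uniq.Unique[x∷xs]⇒x∉xs (unique-resp-↭ (++-comm us (end l a ∷ vs)) u))
      λ m → links (closed-pairs-rotate (end l a ∷ vs) us (pairs-⊆-closed _ (pairs-∷⁺ _ _ m))))
  where
  back : ∀ {P : ℕ → Set} → All P (end l a ∷ vs ++ us) → All P (us ++ end l a ∷ vs)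
  back = All-resp-↭ (↭-sym (++-comm us (end l a ∷ vs)))

-- A cycle that misses the base in both directions lies in one half, and descending into that half
-- adds one step to the context. The descent stops at the first base that the cycle uses, the base
-- of the top node of its region.
cycle-boundary : ∀ t a xs → Unique xs → 3 ≤ length xs →
  (∀ {x y} → (x , y) ∈ closed-pairs xs → Link (Edge t a) x y) → IsBoundary t a xs
cycle-boundary leaf a xs@(x ∷ y ∷ _) u len links with links (here refl)
... | inj₁ (refl , refl) = cycle-through-base′ leaf a xs u len links (here refl)
... | inj₂ (refl , refl) = cycle-through-base leaf a xs u len links (here refl)
cycle-boundary leaf a (x ∷ []) u (s≤s ()) links
cycle-boundary t@(node l r) a xs u len links
  with (end t a , a) ∈ℕ²? closed-pairs xs | (a , end t a) ∈ℕ²? closed-pairs xs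
... | yes m | _     = cycle-through-base t a xs u len links m
... | no _  | yes m = cycle-through-base′ t a xs u len links m
... | no ∌₁ | no ∌₂ = [ left , right ]′ (weak-side l r a xs u half)
  where
  half : ∀ {x y} → (x , y) ∈ closed-pairs xs → HalfLink l r a x y
  half m = halve l r a (λ { (refl , refl) → ∌₂ m }) (λ { (refl , refl) → ∌₁ m }) (links m)
  left : All (_≤ end l a) xs → IsBoundary t a xs
  left all =
    let c , p , eq , rest = cycle-boundary l a xs u len λ m → let i , j = closed-pairs-∈ xs m in
          link-left l r a (half m) (All.lookup all i) (All.lookup all j)
    in (false , r) ∷ c , p , cong (λ s → node s r) eq , rest
  right : All (end l a ≤_) xs → IsBoundary t a xs
  right all =
    let c , p , eq , rest = cycle-boundary r (end l a) xs u len λ m → let i , j = closed-pairs-∈ xs m in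
          link-right l r a (half m) (All.lookup all i) (All.lookup all j)
    in (true , l) ∷ c , p , cong (node l) eq , rest

-- Edge sets and vertices in `Fin n`

module _ {n : ℕ} where

  ⟪⟫⁺ : ∀ {P : Fin n → Fin n → Set} (P? : ∀ i j → Dec (P i j)) i j → P i j → ⟪ P? ⟫ ∋⟨ i , j ⟩
  ⟪⟫⁺ P? i j pij = Vec.lookup⇒[]= j _ (trans (cong (λ s → lookup s j) (Vec.lookup∘tabulate _ i))
    (trans (Vec.lookup∘tabulate _ j) (dec-true (P? i j) pij)))

  ⟪⟫⁻ : ∀ {P : Fin n → Fin n → Set} (P? : ∀ i j → Dec (P i j)) i j → ⟪ P? ⟫ ∋⟨ i , j ⟩ → P i j
  ⟪⟫⁻ P? i j m with P? i j | trans (sym (trans (cong (λ s → lookup s j) (Vec.lookup∘tabulate _ i))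
                                                  (Vec.lookup∘tabulate _ j))) (Vec.[]=⇒lookup m)
  ... | yes pij | _  = pij
  ... | no  _   | ()

  ⊑-antisym : {F G : EdgeSet n} → F ⊑ G → G ⊑ F → F ≡ G
  ⊑-antisym {F} {G} F⊑G G⊑F = trans (sym (Vec.tabulate∘lookup F)) (trans
    (Vec.tabulate-cong λ i → Subset.⊆-antisym (F⊑G i _) (G⊑F i _)) (Vec.tabulate∘lookup G))

  graph⁻ : (D : EdgeSet n) → ∀ i j → graph D ∋⟨ i , j ⟩ → D ∋⟨ i , j ⟩ ⊎ Side i j
  graph⁻ D i j m = Sum.map₂ (⟪⟫⁻ side? i j) (Subset.x∈p∪q⁻ (lookup D i) (lookup (sides n) i)
    (subst (j ∈ˢ_) (Vec.lookup-zipWith _ i D (sides n)) m))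

  graph⁺ : (D : EdgeSet n) → ∀ i j → D ∋⟨ i , j ⟩ ⊎ Side i j → graph D ∋⟨ i , j ⟩
  graph⁺ D i j m = subst (j ∈ˢ_) (sym (Vec.lookup-zipWith _ i D (sides n)))
    (Subset.x∈p∪q⁺ (Sum.map₂ (⟪⟫⁺ side? i j) m))

count-subset : ∀ {n} (s : Subset n) → Count (_∈ˢ s) ∣ s ∣
count-subset []            = count-∅ λ ()
count-subset (outside ∷ s) = count-image (count-subset s) Fin.suc (λ { _ _ refl → refl }) Vec.there
  λ { (Vec.there m) → _ , m , refl }
count-subset (inside ∷ s)  = count-⊕ {P = λ (_ : ⊤) → ⊤} {R = _∈ˢ (inside ∷ s)}
  (count-singleton tt tt λ _ _ → refl) (count-subset s)
  (λ _ → Fin.zero) Fin.suc (λ _ → refl) (λ { refl → refl }) (λ _ _ ()) (λ _ → Vec.here) Vec.there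
  λ { Vec.here → inj₁ (_ , _ , refl) ; (Vec.there m) → inj₂ (_ , m , refl) }

count-edge-set : ∀ {m n} (F : Vec (Subset n) m) →
                 Count (λ ((i , j) : Fin m × Fin n) → j ∈ˢ lookup F i) (Vec.sum (Vec.map ∣_∣ F))
count-edge-set []      = count-∅ λ { (() , _) }
count-edge-set (s ∷ F) = count-⊕ (count-subset s) (count-edge-set F) (Fin.zero ,_) (map₁ Fin.suc)
  (λ { refl → refl }) (λ { refl → refl }) (λ { _ _ () }) id id
  λ { {Fin.zero , j} m → inj₁ (j , m , refl) ; {Fin.suc i , j} m → inj₂ ((i , j) , m , refl) }

module _ {A : Set} {xs : List A} where

  ∈-allVecs : (∀ x → x ∈ xs) → ∀ {m} (v : Vec A m) → v ∈ allVecs xs m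
  ∈-allVecs all []      = here refl
  ∈-allVecs all (x ∷ v) = ∈-cartesianProductWith⁺ _∷_ (all x) (∈-allVecs all v)

  allVecs-unique : Unique xs → ∀ m → Unique (allVecs xs m)
  allVecs-unique u zero    = [] ∷ []
  allVecs-unique u (suc m) =
    Uniq.cartesianProductWith⁺ _∷_ (λ { refl → refl , refl }) u (allVecs-unique u m)

∈-allEdgeSets : ∀ {n} (F : EdgeSet n) → F ∈ allEdgeSets n
∈-allEdgeSets = ∈-allVecs (∈-allVecs λ { false → here refl ; true → there (here refl) })

allEdgeSets-unique : ∀ n → Unique (allEdgeSets n)
allEdgeSets-unique n = allVecs-unique (allVecs-unique (((λ ()) ∷ []) ∷ [] ∷ []) n) n

count-filtered : ∀ {n} {P : EdgeSet n → Set} (P? : Decidable P) →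
                 Count P (length (filter P? (allEdgeSets n)))
count-filtered {n} P? = record
  { list = filter P? (allEdgeSets n) ; unique = Uniq.filter⁺ P? (allEdgeSets-unique n)
  ; sound = λ m → proj₂ (∈-filter⁻ P? {xs = allEdgeSets n} m)
  ; complete = ∈-filter⁺ P? (∈-allEdgeSets _) ; size = refl }

module _ {A : Set} where

  toList-steps : ∀ {m} (v : Vec A m) → toList (steps v) ≡ closed-pairs (toList v)
  toList-steps []       = refl
  toList-steps (x ∷ xs) = shift x xs x
    where
    shift : ∀ {m} x (xs : Vec A m) y → toList (zip (x ∷ xs) (xs ∷ʳ y)) ≡ pairs (x ∷ toList xs ++ y ∷ [])
    shift x []        y = refl
    shift x (x′ ∷ xs) y = cong ((x , x′) ∷_) (shift x′ xs y)

  toList-unique⁺ : ∀ {m} {v : Vec A m} → VecUnique.Unique v → Unique (toList v)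
  toList-unique⁺ VecAllPairs.[]       = []
  toList-unique⁺ (x VecAllPairs.∷ u) = VecAll.toList⁺ x ∷ toList-unique⁺ u

  toList-unique⁻ : ∀ {m} {v : Vec A m} → Unique (toList v) → VecUnique.Unique v
  toList-unique⁻ {v = []}    []      = VecAllPairs.[]
  toList-unique⁻ {v = _ ∷ _} (x ∷ u) = VecAll.toList⁻ x VecAllPairs.∷ toList-unique⁻ u

  pairs-map : ∀ {B : Set} (f : A → B) xs → pairs (map f xs) ≡ map (λ (x , y) → f x , f y) (pairs xs)
  pairs-map f []           = refl
  pairs-map f (x ∷ [])     = refl
  pairs-map f (x ∷ y ∷ xs) = cong ((f x , f y) ∷_) (pairs-map f (y ∷ xs))

  closed-pairs-map : ∀ {B : Set} (f : A → B) xs →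
                     closed-pairs (map f xs) ≡ map (λ (x , y) → f x , f y) (closed-pairs xs)
  closed-pairs-map f []       = refl
  closed-pairs-map f (x ∷ xs) = trans (cong (λ ys → pairs (f x ∷ ys)) (sym (map-++ f xs (x ∷ []))))
                                      (pairs-map f (x ∷ xs ++ x ∷ []))

  pairs-≢ : ∀ {xs : List A} → Unique xs → ∀ {x y} → (x , y) ∈ pairs xs → x ≢ y
  pairs-≢ {_ ∷ _ ∷ _} ((x≢y ∷ _) ∷ _) (here refl) = x≢y
  pairs-≢ {_ ∷ _ ∷ _} (_ ∷ u)         (there m)   = pairs-≢ u m

  closed-pairs-≢ : ∀ {xs : List A} → Unique xs → 2 ≤ length xs → ∀ {x y} → (x , y) ∈ closed-pairs xs → x ≢ y
  closed-pairs-≢ {x ∷ []}     u                 (s≤s ()) m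
  closed-pairs-≢ {x ∷ y ∷ xs} ((x≢y ∷ _) ∷ _) _ (here refl) = x≢y
  closed-pairs-≢ {x ∷ y ∷ xs} u               _ (there m)   =
    pairs-≢ (unique-resp-↭ (++-comm (x ∷ []) (y ∷ xs)) u) m

vertices : ∀ {n k} → Vec (Fin n) k → List ℕ
vertices v = map toℕ (toList v)

module _ {n k : ℕ} (v : Vec (Fin n) k) where

  length-vertices : length (vertices v) ≡ k
  length-vertices = trans (length-map toℕ (toList v)) (Vec.length-toList v)

  vertices-unique : VecUnique.Unique v → Unique (vertices v)
  vertices-unique u = Uniq.map⁺ Fin.toℕ-injective (toList-unique⁺ u)

  vertices-unique⁻ : Unique (vertices v) → VecUnique.Unique v
  vertices-unique⁻ u = toList-unique⁻ (Uniq.map⁻ u)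

  closed-pairs-vertices : closed-pairs (vertices v) ≡ map (λ (i , j) → toℕ i , toℕ j) (toList (steps v))
  closed-pairs-vertices = trans (closed-pairs-map toℕ (toList v)) (cong (map _) (sym (toList-steps v)))

  steps⁺ : ∀ {i j} → (i , j) ∈ᵛ steps v → (toℕ i , toℕ j) ∈ closed-pairs (vertices v)
  steps⁺ m = subst (_ ∈_) (sym closed-pairs-vertices) (∈-map⁺ _ (∈-toList⁺ m))

  steps⁻ : ∀ {x y} → (x , y) ∈ closed-pairs (vertices v) →
           ∃₂ λ i j → x ≡ toℕ i × y ≡ toℕ j × (i , j) ∈ᵛ steps v
  steps⁻ m with (i , j) , m′ , refl ← ∈-map⁻ _ (subst (_ ∈_) closed-pairs-vertices m) =
    i , j , refl , refl , ∈-toList⁻ m′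

  steps⁻′ : ∀ {i j} → (toℕ i , toℕ j) ∈ closed-pairs (vertices v) → (i , j) ∈ᵛ steps v
  steps⁻′ m = let _ , _ , i≡ , j≡ , m′ = steps⁻ m in
    subst₂ (λ i j → (i , j) ∈ᵛ steps v) (sym (Fin.toℕ-injective i≡)) (sym (Fin.toℕ-injective j≡)) m′

fin-vertices : ∀ {n} (xs : List ℕ) → All (_< n) xs → ∃ λ (v : Vec (Fin n) (length xs)) → vertices v ≡ xs
fin-vertices []       []         = [] , refl
fin-vertices (x ∷ xs) (x<n ∷ xs<n) = let v , eq = fin-vertices xs xs<n in
  fromℕ< x<n ∷ v , cong₂ _∷_ (Fin.toℕ-fromℕ< x<n) eq

-- Triangulations and cycles as edge sets

-- The vertices are 0 , … , n - 1, so these are meant for trees with n - 2 nodes.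

diagonals : ∀ n → Tree → EdgeSet n
diagonals n t = ⟪ (λ i j → Edge? t 0 (toℕ i) (toℕ j) ×-dec ¬? (side? i j)) ⟫

boundary : ∀ n → Context → Pruned → EdgeSet n
boundary n c p = ⟪ (λ i j → Boundary? c p 0 (toℕ i) (toℕ j)) ⟫

module _ {n : ℕ} (i j : Fin n) where

  diagonals⁺ : ∀ t → Edge t 0 (toℕ i) (toℕ j) × ¬ Side i j → diagonals n t ∋⟨ i , j ⟩
  diagonals⁺ t = ⟪⟫⁺ (λ i j → Edge? t 0 (toℕ i) (toℕ j) ×-dec ¬? (side? i j)) i j

  diagonals⁻ : ∀ t → diagonals n t ∋⟨ i , j ⟩ → Edge t 0 (toℕ i) (toℕ j) × ¬ Side i j
  diagonals⁻ t = ⟪⟫⁻ (λ i j → Edge? t 0 (toℕ i) (toℕ j) ×-dec ¬? (side? i j)) i j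

  boundary⁺ : ∀ c p → Boundary c p 0 (toℕ i) (toℕ j) → boundary n c p ∋⟨ i , j ⟩
  boundary⁺ c p = ⟪⟫⁺ (λ i j → Boundary? c p 0 (toℕ i) (toℕ j)) i j

  boundary⁻ : ∀ c p → boundary n c p ∋⟨ i , j ⟩ → Boundary c p 0 (toℕ i) (toℕ j)
  boundary⁻ c p = ⟪⟫⁻ (λ i j → Boundary? c p 0 (toℕ i) (toℕ j)) i j

-- Boundary edges are always increasing, so the condition `i < j` in `Consecutive` picks the
-- orientation in which `Boundary` holds.
traces-boundary : ∀ {n k} c p (v : Vec (Fin n) k) → Traces c p 0 (vertices v) →
                  ⟪ consecutive? v ⟫ ≡ boundary n c p
traces-boundary c p v (sub , sup) = ⊑-antisym
  (λ i j m → boundary⁺ i j c p (to (⟪⟫⁻ (consecutive? v) i j m)))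
  (λ i j m → ⟪⟫⁺ (consecutive? v) i j (from (boundary⁻ i j c p m)))
  where
  increasing : ∀ {i j} → Boundary c p 0 i j → i < j
  increasing b = proj₁ (proj₂ (boundary-within c p 0 b))
  orient : ∀ {i j} → i < j → Link (Boundary c p 0) i j → Boundary c p 0 i j
  orient i<j (inj₁ b) = b
  orient i<j (inj₂ b) = ⊥-elim (<-asym i<j (increasing b))
  to : ∀ {i j} → Consecutive v i j → Boundary c p 0 (toℕ i) (toℕ j)
  to (i<j , m) = orient i<j ([ sub ∘ steps⁺ v , Sum.swap ∘ sub ∘ steps⁺ v ]′ m)
  from : ∀ {i j} → Boundary c p 0 (toℕ i) (toℕ j) → Consecutive v i j
  from b = increasing b , Sum.map (steps⁻′ v) (steps⁻′ v) (sup b)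

module _ (t : Tree) (m : ℕ) (nodes≡ : nodes t ≡ m) where

  private
    n : ℕ
    n = suc (suc m)
    end-t : end t 0 ≡ suc m
    end-t = trans (end≡ t 0) (cong suc nodes≡)

  edge-bounds : ∀ {i j} → Edge t 0 i j → i < n × j < n
  edge-bounds e = let _ , i<j , j≤ = edge-within t 0 e
                      j<n = s≤s (≤-trans j≤ (≤-reflexive end-t)) in <-trans i<j j<n , j<n

  side-is-edge : ∀ {i j : Fin n} → Side i j → Edge t 0 (toℕ i) (toℕ j)
  side-is-edge {i} {j} (inj₁ eq) = subst (Edge t 0 (toℕ i)) eq (side-edge t 0 (toℕ i) z≤n
    (subst (toℕ i <_) (sym end-t) (≤-pred (≤-trans (s≤s (≤-reflexive eq)) (Fin.toℕ<n j)))))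
  side-is-edge (inj₂ (i≡0 , 1+j≡n)) = subst₂ (Edge t 0) (sym i≡0)
    (trans end-t (sym (suc-injective 1+j≡n))) (base-edge t 0)

  graph-diagonals⁻ : ∀ i j → graph (diagonals n t) ∋⟨ i , j ⟩ → Edge t 0 (toℕ i) (toℕ j)
  graph-diagonals⁻ i j = [ proj₁ ∘ diagonals⁻ i j t , side-is-edge ]′ ∘ graph⁻ (diagonals n t) i j

  graph-diagonals⁺ : ∀ i j → Edge t 0 (toℕ i) (toℕ j) → graph (diagonals n t) ∋⟨ i , j ⟩
  graph-diagonals⁺ i j e with side? i j
  ... | yes s = graph⁺ (diagonals n t) i j (inj₂ s)
  ... | no ¬s = graph⁺ (diagonals n t) i j (inj₁ (diagonals⁺ i j t (e , ¬s)))

count-sides : ∀ m → Count (λ ((i , j) : Fin (3 + m) × Fin (3 + m)) → Side i j) (3 + m)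
count-sides m = subst (Count _) (+-comm (2 + m) 1)
  (count-⊎ path (count-singleton (Fin.zero , fromℕ (2 + m)) (refl , cong suc (Fin.toℕ-fromℕ (2 + m)))
    λ { (i , j) (i≡ , j≡) → cong₂ _,_ (Fin.toℕ-injective i≡)
          (Fin.toℕ-injective (trans (suc-injective j≡) (sym (Fin.toℕ-fromℕ (2 + m))))) })
    -- The closing side from 0 to `n - 1` differs from the sides between successive vertices because
    -- the polygon has at least three vertices.
    λ { (i , j) e (i≡0 , 1+j≡n) → 1≢2+m (trans (cong suc (sym i≡0)) (trans e (suc-injective 1+j≡n))) })
  where
  1≢2+m : 1 ≢ 2 + m
  1≢2+m ()
  all : Count (λ (_ : Fin (2 + m)) → ⊤) (2 + m)
  all = record { list = allFin (2 + m) ; unique = Uniq.allFin⁺ (2 + m) ; sound = λ _ → tt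
               ; complete = λ _ → ∈-allFin _ ; size = length-tabulate id }
  path : Count (λ ((i , j) : Fin (3 + m) × Fin (3 + m)) → suc (toℕ i) ≡ toℕ j) (2 + m)
  path = count-image all (λ i → inject₁ i , Fin.suc i) (λ { _ _ e → Fin.suc-injective (cong proj₂ e) })
    (λ {i} _ → cong suc (Fin.toℕ-inject₁ i))
    λ { {i , Fin.suc j} e → j , tt , cong (_, Fin.suc j)
        (Fin.toℕ-injective (trans (suc-injective e) (sym (Fin.toℕ-inject₁ j)))) }

-- Diagonals and sides together are the edges of the tree, so the number is `2(m + 1) + 1` minus the
-- `m + 3` sides.
diagonals-number : ∀ t m → nodes t ≡ suc m → ∥ diagonals (3 + m) t ∥ ≡ m
diagonals-number t m nodes≡ = +-cancelʳ-≡ (3 + m) _ _ (trans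
  (count-unique (count-image
    (count-⊎ (count-edge-set (diagonals (3 + m) t)) (count-sides m)
      λ (i , j) d s → proj₂ (diagonals⁻ i j t d) s)
    (λ (i , j) → toℕ i , toℕ j)
    (λ _ _ e → cong₂ _,_ (Fin.toℕ-injective (cong proj₁ e)) (Fin.toℕ-injective (cong proj₂ e)))
    (λ {(i , j)} d → graph-diagonals⁻ t (suc m) nodes≡ i j (graph⁺ (diagonals (3 + m) t) i j d))
    (λ {(x , y)} e → let x<n , y<n = edge-bounds t (suc m) nodes≡ e
                         x≡ = Fin.toℕ-fromℕ< x<n
                         y≡ = Fin.toℕ-fromℕ< y<n in
      (fromℕ< x<n , fromℕ< y<n)
      , graph⁻ (diagonals (3 + m) t) _ _
          (graph-diagonals⁺ t (suc m) nodes≡ _ _ (subst₂ (Edge t 0) (sym x≡) (sym y≡) e))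
      , cong₂ _,_ (sym x≡) (sym y≡)))
    (count-edges t 0))
  (trans (cong (λ z → suc (2 * z)) nodes≡) (shuffle m)))
  where
  shuffle : ∀ m → suc (2 * suc m) ≡ m + (3 + m)
  shuffle = solve-∀

diagonals-triangulation : ∀ t m → nodes t ≡ suc m → IsTriangulation (diagonals (3 + m) t)
diagonals-triangulation t m nodes≡ = diagonals-number t m nodes≡ ,
  (λ i j d → let e , ¬s = diagonals⁻ i j t d in proj₁ (proj₂ (edge-within t 0 e)) , ¬s) ,
  λ a b c d e f (a<c , c<b , b<d) →
    edge-noncrossing t 0 (proj₁ (diagonals⁻ a b t e)) (proj₁ (diagonals⁻ c d t f)) a<c c<b b<d

-- A triangulation is contained in the diagonals of a tree by extend, and
-- equals them because both have n - 3 elements.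

triangulation-diagonals : ∀ m (D : EdgeSet (3 + m)) → IsTriangulation D →
                          ∃ λ t → nodes t ≡ suc m × D ≡ diagonals (3 + m) t
triangulation-diagonals m D (∥D∥≡ , diagonal , noncrossing) = t , nodes≡ ,
  ⊑-antisym D⊑t (λ i j → count-⊆-⊇
    (count-edge-set D) (subst (Count _) (trans (diagonals-number t m nodes≡) (sym ∥D∥≡))
      (count-edge-set (diagonals (3 + m) t)))
    (λ (i , j) → D ∋?⟨ i , j ⟩) (λ {(i , j)} → D⊑t i j))
  where
  n = 3 + m
  R : ℕ → ℕ → Set
  R x y = ∃ λ i → ∃ λ j → toℕ i ≡ x × toℕ j ≡ y × D ∋⟨ i , j ⟩
  R? : ∀ x y → Dec (R x y)
  R? x y = Fin.any? λ i → Fin.any? λ j → (toℕ i ≟ x) ×-dec (toℕ j ≟ y) ×-dec (D ∋?⟨ i , j ⟩)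
  ext = extend R R? (λ { (a , b , refl , refl , e) (c , d , refl , refl , f) x y z →
                         noncrossing a b c d e f (x , y , z) }) (suc m) 0 (suc m) ≤-refl
  t = proj₁ ext
  nodes≡ = proj₁ (proj₂ ext)
  D⊑t : D ⊑ diagonals n t
  D⊑t i j d = let i<j , ¬s = diagonal i j d in
    diagonals⁺ i j t
      (proj₂ (proj₂ ext) (i , j , refl , refl , d) (z≤n , i<j , ≤-pred (Fin.toℕ<n j)) , ¬s)

diagonals-injective : ∀ t t′ m → nodes t ≡ m → nodes t′ ≡ m →
                      diagonals (2 + m) t ≡ diagonals (2 + m) t′ → t ≡ t′
diagonals-injective t t′ m e e′ eq = edge-injective t t′ 0
  (trans (end≡ t 0) (trans (cong suc (trans e (sym e′))) (sym (end≡ t′ 0))))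
  λ {x} {y} f → let x<n , y<n = edge-bounds t m e f
                    x≡ = Fin.toℕ-fromℕ< x<n
                    y≡ = Fin.toℕ-fromℕ< y<n in
    subst₂ (Edge t′ 0) x≡ y≡ (graph-diagonals⁻ t′ m e′ _ _
      (subst (λ D → graph D ∋⟨ fromℕ< x<n , fromℕ< y<n ⟩) eq
        (graph-diagonals⁺ t m e _ _ (subst₂ (Edge t 0) (sym x≡) (sym y≡) f))))

count-triangulations : ∀ m → Count (IsTriangulation {3 + m}) (ballot 1 (suc m))
count-triangulations m = count-image (count-forests 1 (suc m)) (λ { (t ∷ []) → diagonals (3 + m) t })
  (λ { {t ∷ []} {t′ ∷ []} e e′ eq → cong (_∷ []) (diagonals-injective t t′ (suc m) (size e) (size e′) eq) })
  (λ { {t ∷ []} e → diagonals-triangulation t m (size e) })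
  (λ {D} tri → let t , e , eq = triangulation-diagonals m D tri in t ∷ [] , trans (+-identityʳ _) e , eq)
  where
  size : ∀ {x} → x + 0 ≡ suc m → x ≡ suc m
  size = trans (sym (+-identityʳ _))

polygon-bounds : ∀ c p a → All (_≤ end (plug c (forget p)) a) (polygon c p a)
polygon-bounds []                p a = sorted-last (a ∷ inner p a) (inner-sorted p a)
  where
  sorted-last : ∀ xs {z} → AllPairs _<_ (xs ++ z ∷ []) → All (_≤ z) (xs ++ z ∷ [])
  sorted-last []       _       = ≤-refl ∷ []
  sorted-last (x ∷ xs) (x< ∷ s) with _ , x<z ∷ [] ← All.++⁻ xs x< = <⇒≤ x<z ∷ sorted-last xs s
polygon-bounds ((false , r) ∷ c) p a =
  All.map (λ x≤ → ≤-trans x≤ (<⇒≤ (a<end r _))) (polygon-bounds c p a)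
polygon-bounds ((true  , l) ∷ c) p a = polygon-bounds c p (end l a)

boundary-cycle : ∀ c p m → nodes (plug c (forget p)) ≡ m → IsCycle (2 + kept p) (boundary (2 + m) c p)
boundary-cycle c p m e = subst (λ k → IsCycle k (boundary (2 + m) c p)) (length-polygon c p 0)
  (proj₁ v , vertices-unique⁻ (proj₁ v) (subst Unique (sym (proj₂ v)) (polygon-unique c p 0)) ,
   sym (traces-boundary c p (proj₁ v) (subst (Traces c p 0) (sym (proj₂ v)) (polygon-traces c p 0))))
  where
  v = fin-vertices {2 + m} (polygon c p 0) (All.map
    (λ x≤ → s≤s (≤-trans x≤ (≤-reflexive (trans (end≡ (plug c (forget p)) 0) (cong suc e)))))
    (polygon-bounds c p 0))

boundary-⊑ : ∀ c p m → nodes (plug c (forget p)) ≡ m →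
             boundary (2 + m) c p ⊑ graph (diagonals (2 + m) (plug c (forget p)))
boundary-⊑ c p m e i j b = graph-diagonals⁺ (plug c (forget p)) m e i j
  (boundary-edge c p 0 (boundary⁻ i j c p b))

cycle-is-boundary : ∀ t m j → nodes t ≡ m → (F : EdgeSet (2 + m)) → F ⊑ graph (diagonals (2 + m) t) →
  IsCycle (3 + j) F → ∃₂ λ c p → plug c (forget p) ≡ t × kept p ≡ suc j × F ≡ boundary (2 + m) c p
cycle-is-boundary t m j e F F⊑ (v , u , refl) =
  let c , p , eq , len , traces = cycle-boundary t 0 (vertices v) u′ 3≤ links in
  c , p , eq , suc-injective (suc-injective (trans (sym len) (length-vertices v))) , traces-boundary c p v traces
  where
  u′ = vertices-unique v u
  3≤ : 3 ≤ length (vertices v)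
  3≤ = ≤-trans (s≤s (s≤s (s≤s z≤n))) (≤-reflexive (sym (length-vertices v)))
  edge : ∀ i j → Consecutive v i j → Edge t 0 (toℕ i) (toℕ j)
  edge i j m′ = graph-diagonals⁻ t m e i j (F⊑ i j (⟪⟫⁺ (consecutive? v) i j m′))
  links : ∀ {x y} → (x , y) ∈ closed-pairs (vertices v) → Link (Edge t 0) x y
  links m with i , j , refl , refl , m′ ← steps⁻ v m with <-cmp (toℕ i) (toℕ j)
  ... | tri< i<j _ _ = inj₁ (edge i j (i<j , inj₁ m′))
  -- `Consecutive` speaks only of pairs with `i < j`, so a step from a vertex to itself has to be
  -- ruled out separately.
  ... | tri≈ _ i≡j _ = ⊥-elim (closed-pairs-≢ u′ (≤-trans (n≤1+n 2) 3≤) m i≡j)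
  ... | tri> _ _ j<i = inj₂ (edge j i (j<i , inj₂ m′))

-- The diagonals recover the whole tree; inside a fixed tree the boundary recovers the context and
-- the pruning.
encoding-injective : ∀ c p c′ p′ m → Branched p → Branched p′ →
  nodes (plug c (forget p)) ≡ m → nodes (plug c′ (forget p′)) ≡ m →
  diagonals (2 + m) (plug c (forget p)) ≡ diagonals (2 + m) (plug c′ (forget p′)) →
  boundary (2 + m) c p ≡ boundary (2 + m) c′ p′ → (c , p) ≡ (c′ , p′)
encoding-injective c p c′ p′ m b b′ e e′ eq eq′ = boundary-injective c p c′ p′ 0 b b′
  (diagonals-injective _ _ m e e′ eq) (transport c p c′ p′ e eq′) (transport c′ p′ c p e′ (sym eq′))
  where
  transport : ∀ c p c′ p′ → nodes (plug c (forget p)) ≡ m → boundary (2 + m) c p ≡ boundary (2 + m) c′ p′ →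
              ∀ {x y} → Boundary c p 0 x y → Boundary c′ p′ 0 x y
  transport c p c′ p′ e eq f =
    let x<n , y<n = edge-bounds (plug c (forget p)) m e (boundary-edge c p 0 f)
        x≡ = Fin.toℕ-fromℕ< x<n
        y≡ = Fin.toℕ-fromℕ< y<n in
    subst₂ (Boundary c′ p′ 0) x≡ y≡ (boundary⁻ _ _ c′ p′
      (subst (λ F → F ∋⟨ fromℕ< x<n , fromℕ< y<n ⟩) eq
        (boundary⁺ _ _ c p (subst₂ (Boundary c p 0) (sym x≡) (sym y≡) f))))

module _ {n : ℕ} (k : ℕ) (G : EdgeSet n) where

  private
    cycleIn? : ∀ F → _
    cycleIn? F = (F ⊑? G) ×-dec isCycle? k F

  cycles⁺ : ∀ F → F ⊑ G × IsCycle k F → F ∈ cycles k G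
  cycles⁺ F = ∈-filter⁺ cycleIn? (∈-allEdgeSets F)

  cycles⁻ : ∀ F → F ∈ cycles k G → F ⊑ G × IsCycle k F
  cycles⁻ F F∈ = proj₂ (∈-filter⁻ cycleIn? {xs = allEdgeSets n} F∈)

  cycles-unique : Unique (cycles k G)
  cycles-unique = Uniq.filter⁺ cycleIn? (allEdgeSets-unique n)

-- Here `k = 3 + j` and `n = k + q`. A stack with no released tree and one pruned tree is a context
-- with a pruned tree in it: `suc j = k - 2` nodes are kept and `q = n - k` lie outside, so the
-- upper index is `2(n - k) + (k - 1)`.
count-cycles : ∀ j q → let n = 3 + (j + q) in
  Count (λ ((D , F) : EdgeSet n × EdgeSet n) → IsTriangulation D × F ∈ cycles (3 + j) (graph D))
        (ballot 1 (suc j) * ((q + q + suc (suc j)) C q))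
count-cycles j q = count-image (count-stacks 0 1 (suc j) q) encode injective
  (λ { {([] , c) , p ∷ []} e → into c p e })
  (λ { {D , F} (tri , F∈) → onto D F tri F∈ })
  where
  m = j + q
  n = 3 + m
  encode : Stack 0 1 → EdgeSet n × EdgeSet n
  encode (([] , c) , p ∷ []) = diagonals n (plug c (forget p)) , boundary n c p
  kept≡ : ∀ c p → HasSize (suc j) q (([] , c) , p ∷ []) → kept p ≡ suc j
  kept≡ c p (e , _) = trans (sym (+-identityʳ _)) e
  nodes≡ : ∀ c p → HasSize (suc j) q (([] , c) , p ∷ []) → nodes (plug c (forget p)) ≡ suc m
  nodes≡ c p (e , f) = begin
    nodes (plug c (forget p))                    ≡⟨ nodes-plug c (forget p) ⟩
    nodes (forget p) + context-nodes c           ≡⟨ cong (_+ context-nodes c) (nodes-forget p) ⟩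
    kept p + lost p + context-nodes c            ≡⟨ shuffle (kept p) (lost p) (context-nodes c) ⟩
    (kept p + 0) + (context-nodes c + (lost p + 0)) ≡⟨ cong₂ _+_ e f ⟩
    suc m ∎
    where
    open ≡-Reasoning
    shuffle : ∀ a b c → a + b + c ≡ (a + 0) + (c + (b + 0))
    shuffle = solve-∀
  into : ∀ c p → HasSize (suc j) q (([] , c) , p ∷ []) →
         IsTriangulation (diagonals n (plug c (forget p))) ×
         boundary n c p ∈ cycles (3 + j) (graph (diagonals n (plug c (forget p))))
  into c p e = diagonals-triangulation _ m (nodes≡ c p e) ,
    cycles⁺ (3 + j) (graph (diagonals n (plug c (forget p)))) (boundary n c p)
      (boundary-⊑ c p (suc m) (nodes≡ c p e) ,
       subst (λ k → IsCycle k (boundary n c p)) (cong (λ i → suc (suc i)) (kept≡ c p e))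
         (boundary-cycle c p (suc m) (nodes≡ c p e)))
  injective : ∀ {x y} → HasSize (suc j) q x → HasSize (suc j) q y → encode x ≡ encode y → x ≡ y
  injective {([] , c) , p ∷ []} {([] , c′) , p′ ∷ []} e e′ eq =
    cong (λ (c , p) → ([] , c) , p ∷ []) (encoding-injective c p c′ p′ (suc m)
      (≤-trans (s≤s z≤n) (≤-reflexive (sym (kept≡ c p e))))
      (≤-trans (s≤s z≤n) (≤-reflexive (sym (kept≡ c′ p′ e′))))
      (nodes≡ c p e) (nodes≡ c′ p′ e′) (cong proj₁ eq) (cong proj₂ eq))
  size : ∀ c p → kept p ≡ suc j → nodes (plug c (forget p)) ≡ suc m → HasSize (suc j) q (([] , c) , p ∷ [])
  onto : ∀ D F → IsTriangulation D → F ∈ cycles (3 + j) (graph D) →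
         ∃ λ x → HasSize (suc j) q x × (D , F) ≡ encode x
  onto D F tri F∈ =
    let t , t≡ , D≡ = triangulation-diagonals m D tri
        F⊑ , cyc = cycles⁻ (3 + j) (graph D) F F∈
        c , p , plug≡ , k≡ , F≡ = cycle-is-boundary t (suc m) j t≡ F (subst (λ E → F ⊑ graph E) D≡ F⊑) cyc
    in (([] , c) , p ∷ []) , size c p k≡ (trans (cong nodes plug≡) t≡)
       , cong₂ _,_ (trans D≡ (cong (diagonals n) (sym plug≡))) F≡
  size c p k≡ nodes≡ = trans (+-identityʳ _) k≡ , +-cancelˡ-≡ (suc j) _ _ (begin
    suc j + (context-nodes c + (lost p + 0))   ≡⟨ cong (_+ (context-nodes c + (lost p + 0))) k≡ ⟨
    kept p + (context-nodes c + (lost p + 0))  ≡⟨ shuffle (kept p) (lost p) (context-nodes c) ⟩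
    kept p + lost p + context-nodes c          ≡⟨ cong (_+ context-nodes c) (nodes-forget p) ⟨
    nodes (forget p) + context-nodes c         ≡⟨ nodes-plug c (forget p) ⟨
    nodes (plug c (forget p))                  ≡⟨ nodes≡ ⟩
    suc j + q                                  ∎)
    where
    open ≡-Reasoning
    shuffle : ∀ a b c → a + (c + (b + 0)) ≡ a + b + c
    shuffle = solve-∀

-- The average as a rational number

number-of-triangulations : ∀ m → length (triangulations (3 + m)) ≡ ballot 1 (suc m)
number-of-triangulations m = count-unique (count-filtered isTriangulation?) (count-triangulations m)

total-cycles : ℕ → ℕ → ℕ
total-cycles n k = sum (map (λ D → length (cycles k (graph D))) (triangulations n))

count-pairs : ∀ n k → Count (λ ((D , F) : EdgeSet n × EdgeSet n) → IsTriangulation D × F ∈ cycles k (graph D))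
                            (total-cycles n k)
count-pairs n k = count-Σ (count-filtered isTriangulation?) (λ D → cycles k (graph D))
                          (λ D → cycles-unique k (graph D))

total-number-of-cycles : ∀ j q → total-cycles (3 + (j + q)) (3 + j) ≡
                                 ballot 1 (suc j) * ((q + q + suc (suc j)) C q)
total-number-of-cycles j q = count-unique (count-pairs (3 + (j + q)) (3 + j)) (count-cycles j q)

-- Keeps `mean` away from its dummy value and puts its denominator into the form `suc b`. Positivity
-- is inherited from the central binomial coefficient.
ballot-positive : ∀ q → ∃ λ b → ballot 1 q ≡ suc b
ballot-positive q with ballot 1 q | ballot-catalan q
... | suc b | _  = b , refl
... | zero  | eq = ⊥-elim (<-irrefl (trans (sym (*-zeroʳ (suc q))) eq) (nCk>0 (m≤m+n q (q + 0))))

mean≡ : ∀ xs c → length xs ≡ suc c → mean xs ≡ + sum xs / suc c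
mean≡ (x ∷ xs) c refl = refl

averageCycles≡ : ∀ n k c → length (triangulations n) ≡ suc c → averageCycles n k ≡ + total-cycles n k / suc c
averageCycles≡ n k c eq = mean≡ (map (λ D → length (cycles k (graph D))) (triangulations n)) c
  (trans (length-map _ (triangulations n)) eq)

/-scale : ∀ a c → + (suc c * a) / suc c ≡ + a / 1
/-scale a c = ℚ.fromℚᵘ-cong {mkℚᵘ (+ (suc c * a)) c} {mkℚᵘ (+ a) 0} (*≡* (trans (ℤ.*-identityʳ _)
  (trans (cong +_ (*-comm (suc c) a)) (ℤ.pos-* a (suc c)))))

/-* : ∀ a b c → (+ a / suc c) ℚ.* (+ b / 1) ≡ + (a * b) / suc c
/-* a b c = ℚ.toℚᵘ-injective (begin
  ℚ.toℚᵘ ((+ a / suc c) ℚ.* (+ b / 1))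
    ≈⟨ ℚ.toℚᵘ-homo-* (+ a / suc c) (+ b / 1) ⟩
  ℚ.toℚᵘ (+ a / suc c) ℚᵘ.* ℚ.toℚᵘ (+ b / 1)
    ≈⟨ ℚᵘ.*-cong (ℚ.toℚᵘ-fromℚᵘ (mkℚᵘ (+ a) c)) (ℚ.toℚᵘ-fromℚᵘ (mkℚᵘ (+ b) 0)) ⟩
  mkℚᵘ (+ a) c ℚᵘ.* mkℚᵘ (+ b) 0
    ≈⟨ *≡* (cong₂ ℤ._*_ (sym (ℤ.pos-* a b)) (cong (λ d → + suc d) (sym (*-identityʳ c)))) ⟩
  mkℚᵘ (+ (a * b)) c
    ≈⟨ ℚ.toℚᵘ-fromℚᵘ (mkℚᵘ (+ (a * b)) c) ⟨
  ℚ.toℚᵘ (+ (a * b) / suc c) ∎)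
  where open ℚᵘ.≃-Reasoning

catalan≡ballot : ∀ m → catalan m ≡ + ballot 1 m / 1
catalan≡ballot m = trans (cong (λ a → + a / suc m) (sym (ballot-catalan m))) (/-scale (ballot 1 m) m)

quotient : ∀ x g p q .{{_ : ℚ.NonZero q}} → x ℚ.* q ≡ g ℚ.* p → x ≡ g ℚ.* (p ÷ q)
quotient x g p q eq = begin
  x                          ≡⟨ ℚ.*-identityʳ x ⟨
  x ℚ.* ℚ.1ℚ                 ≡⟨ cong (x ℚ.*_) (ℚ.*-inverseʳ q) ⟨
  x ℚ.* (q ℚ.* (ℚ.1/ q))     ≡⟨ ℚ.*-assoc x q (ℚ.1/ q) ⟨
  x ℚ.* q ℚ.* (ℚ.1/ q)       ≡⟨ cong (ℚ._* (ℚ.1/ q)) eq ⟩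
  g ℚ.* p ℚ.* (ℚ.1/ q)       ≡⟨ ℚ.*-assoc g p (ℚ.1/ q) ⟩
  g ℚ.* (p ÷ q)              ∎
  where open ≡-Reasoning

-- The number of triangulations and `catalan (n - 2)` are both `ballot 1 (n - 2)`, so multiplying by
-- the latter clears the denominator of the mean.
average : ∀ j q → let n = 3 + (j + q) in
  averageCycles n (3 + j) ℚ.* catalan (suc (j + q)) ≡
  (+ ((q + q + suc (suc j)) C q) / 1) ℚ.* catalan (suc j)
average j q = begin
  averageCycles n (3 + j) ℚ.* catalan (suc (j + q))
    ≡⟨ cong₂ ℚ._*_ (averageCycles≡ n (3 + j) b (trans (number-of-triangulations (j + q)) b≡))
                   (trans (catalan≡ballot (suc (j + q))) (cong (λ c → + c / 1) b≡)) ⟩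
  (+ Σ-cycles / suc b) ℚ.* (+ suc b / 1)
    ≡⟨ /-* Σ-cycles (suc b) b ⟩
  + (Σ-cycles * suc b) / suc b
    ≡⟨ cong (λ a → + a / suc b) (*-comm Σ-cycles (suc b)) ⟩
  + (suc b * Σ-cycles) / suc b
    ≡⟨ /-scale Σ-cycles b ⟩
  + Σ-cycles / 1
    ≡⟨ cong (λ a → + a / 1) (trans (total-number-of-cycles j q) (*-comm (ballot 1 (suc j)) G)) ⟩
  + (G * ballot 1 (suc j)) / 1
    ≡⟨ /-* G (ballot 1 (suc j)) 0 ⟨
  (+ G / 1) ℚ.* (+ ballot 1 (suc j) / 1)
    ≡⟨ cong ((+ G / 1) ℚ.*_) (catalan≡ballot (suc j)) ⟨
  (+ G / 1) ℚ.* catalan (suc j) ∎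
  where
  open ≡-Reasoning
  n = 3 + (j + q)
  b = proj₁ (ballot-positive (suc (j + q)))
  b≡ = proj₂ (ballot-positive (suc (j + q)))
  G = (q + q + suc (suc j)) C q
  Σ-cycles = total-cycles n (3 + j)

-- The lower indices `n - k = q` and `n - 1` are complementary: they add up to `2n - k - 1`.
binomial≡ : ∀ j q → let n = 3 + (j + q) in
            (q + q + suc (suc j)) C q ≡ (2 * n ∸ (3 + j) ∸ 1) C (n ∸ 1)
binomial≡ j q = begin
  (q + q + suc (suc j)) C q                ≡⟨ cong (_C q) (+-assoc q q (suc (suc j))) ⟩
  (q + (q + suc (suc j))) C q              ≡⟨ C-symmetric q (q + suc (suc j)) ⟩
  (q + (q + suc (suc j))) C (q + suc (suc j)) ≡⟨ cong₂ _C_ (sym top) (bottom j q) ⟩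
  (2 * (3 + (j + q)) ∸ (3 + j) ∸ 1) C (2 + (j + q)) ∎
  where
  open ≡-Reasoning
  bottom : ∀ j q → q + suc (suc j) ≡ suc (suc (j + q))
  bottom = solve-∀
  double : ∀ j q → 2 * (3 + (j + q)) ≡ (3 + j) + suc (q + (q + suc (suc j)))
  double = solve-∀
  top : 2 * (3 + (j + q)) ∸ (3 + j) ∸ 1 ≡ q + (q + suc (suc j))
  top = cong (_∸ 1) (trans (cong (_∸ (3 + j)) (double j q)) (m+n∸m≡n (3 + j) _))

corollary7 : (n k : ℕ) → 3 ≤ k → k < n →
    averageCycles n k ≡
    (+ ((2 * n ∸ k ∸ 1) C (n ∸ 1)) / 1) ℚ.*
    (_÷_ (catalan (k ∸ 2)) (catalan (n ∸ 2)) {{catalan-nonZero (n ∸ 2)}})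
corollary7 (suc (suc (suc m))) (suc (suc (suc j))) (s≤s (s≤s (s≤s z≤n))) (s≤s (s≤s (s≤s j<m))) =
  -- `q` is `n - k`; replacing `m` by `j + q` removes the truncated subtractions from the counting
  -- argument.
  let q , j+q≡m = m≤n⇒∃[o]m+o≡n (<⇒≤ j<m) in
  quotient (averageCycles (3 + m) (3 + j)) (+ ((2 * (3 + m) ∸ (3 + j) ∸ 1) C (2 + m)) / 1)
    (catalan (suc j)) (catalan (suc m)) {{catalan-nonZero (suc m)}}
    (subst (λ m → averageCycles (3 + m) (3 + j) ℚ.* catalan (suc m) ≡
                  (+ ((2 * (3 + m) ∸ (3 + j) ∸ 1) C (2 + m)) / 1) ℚ.* catalan (suc j)) j+q≡m
      (trans (average j q) (cong (λ N → (+ N / 1) ℚ.* catalan (suc j)) (binomial≡ j q))))
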